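{- Let $G$ be a graph of order $n$. Then $\phi(G)\le 10^{n/5}$. Furthermore, $\phi(G)=10^{n/5}$ if and only if $n\equiv 0\pmod 5$ and $G$ is the disjoint union of $n/5$ graphs each of which is isomorphic to a graph obtained from the complete graph $K_5$ by deleting $i$ pairwise non-adjacent edges (i.e. edges forming a matching), for some $0\le i\le 2$ (the value of $i$ may differ between the copies).
   Context: All graphs are finite, simple, undirected and labeled. A subset of vertices $F$ of a graph $G$ is a dissociation set if the induced subgraph $G[F]$ has maximum degree at most $1$. A maximal dissociation set is a dissociation set that is not a proper subset of any other dissociation set. $\phi(G)$ denotes the number of maximal dissociation sets of $G$. -}

module Defs where

open import Data.Bool using (Bool; true; false; _∧_; T)
open import Data.Nat using (ℕ; zero; suc; _≤_; _*_; _≤?_)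
open import Data.Fin using (Fin; remQuot; _≟_)
open import Data.Fin.Properties using (all?)
open import Data.Fin.Subset using (Subset; inside; outside; _∈_; _∉_; _∩_; _⊂_; ∣_∣)
open import Data.Fin.Subset.Properties using (_∈?_; _⊂?_; anySubset?)
open import Data.List using (List; []; _∷_; _++_; map; filter; length)
open import Data.List.Membership.Propositional using () renaming (_∈_ to _∈ₗ_)
open import Data.List.Relation.Unary.All using (All)
open import Data.List.Relation.Unary.AllPairs using (AllPairs)
open import Data.Vec using (Vec; []; _∷_; tabulate)
open import Data.Product using (_×_; _,_; ∃-syntax; ∃; Σ)
open import Data.Sum using (_⊎_)
open import Function.Bundles using (_⇔_)
open import Function.Definitions using (Bijective)
open import Relation.Binary.PropositionalEquality using (_≡_; _≢_)
open import Relation.Nullary using (¬_; Dec; does)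
open import Relation.Nullary.Decidable using (_×-dec_; ¬?; _→-dec_)
open import Relation.Unary using (Decidable)

record Graph (n : ℕ) : Set where
  field
    Adj   : Fin n → Fin n → Bool
    sym   : ∀ u v → Adj u v ≡ Adj v u
    loopless : ∀ v → Adj v v ≡ false
open Graph public

N : ∀ {n} → Graph n → Fin n → Subset n
N G v = tabulate (λ u → Adj G v u)

IsDissociation : ∀ {n} → Graph n → Subset n → Set
IsDissociation {n} G F = ∀ (v : Fin n) → v ∈ F → ∣ N G v ∩ F ∣ ≤ 1

IsMaximalDissociation : ∀ {n} → Graph n → Subset n → Set
IsMaximalDissociation G F =
  IsDissociation G F × ¬ (∃[ F′ ] (IsDissociation G F′ × F ⊂ F′))

isDissociation? : ∀ {n} (G : Graph n) → Decidable (IsDissociation G)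
isDissociation? G F = all? (λ v → (v ∈? F) →-dec (∣ N G v ∩ F ∣ ≤? 1))

isMaximalDissociation? : ∀ {n} (G : Graph n) → Decidable (IsMaximalDissociation G)
isMaximalDissociation? G F =
  isDissociation? G F ×-dec ¬? (anySubset? (λ F′ → isDissociation? G F′ ×-dec (F ⊂? F′)))

allSubsets : (n : ℕ) → List (Subset n)
allSubsets zero    = [] ∷ []
allSubsets (suc n) = map (inside ∷_) (allSubsets n) ++ map (outside ∷_) (allSubsets n)

φ : ∀ {n} → Graph n → ℕ
φ {n} G = length (filter (isMaximalDissociation? G) (allSubsets n))

-- H (on vertex set Fin 5) is a graph obtained from K₅ by deleting i pairwise
-- non-adjacent edges (a matching M with |M| = i), for some 0 ≤ i ≤ 2.
-- Edges of M are given as ordered pairs (a , b) with a ≢ b; pairs are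
-- pairwise vertex-disjoint (so in particular distinct edges).
VertexDisjoint : Fin 5 × Fin 5 → Fin 5 × Fin 5 → Set
VertexDisjoint (a , b) (c , d) = a ≢ c × a ≢ d × b ≢ c × b ≢ d

IsK5MinusMatching : Graph 5 → Set
IsK5MinusMatching H =
  ∃[ M ] ( length M ≤ 2
         × All (λ e → Data.Product.proj₁ e ≢ Data.Product.proj₂ e) M
         × AllPairs VertexDisjoint M
         × (∀ u v → (Adj H u v ≡ true) ⇔ (u ≢ v × ¬ (((u , v) ∈ₗ M) ⊎ ((v , u) ∈ₗ M)))) )
  where import Data.Product

unionAdj : ∀ {k} → (Fin k → Graph 5) → Fin (k * 5) → Fin (k * 5) → Bool
unionAdj {k} Hs x y with remQuot {k} 5 x | remQuot {k} 5 y
... | a , i | b , j = does (a ≟ b) ∧ Adj (Hs a) i j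

IsoToUnion : ∀ {n k} → Graph n → (Fin k → Graph 5) → Set
IsoToUnion {n} {k} G Hs =
  ∃[ f ] (Bijective {A = Fin n} {B = Fin (k * 5)} _≡_ _≡_ f
          × (∀ u v → Adj G u v ≡ unionAdj Hs (f u) (f v)))

{-# OPTIONS --safe #-}
-- Let S be a maximal dissociation set of G. If D is a union of components of G[S] and R contains D,
-- all neighbours of D and otherwise only vertices outside S, then S ∖ R is a maximal dissociation set
-- of G ∖ R. Hence a case distinction on S that fixes S ∩ R in each case bounds φ(G) by a sum of terms
-- φ(G ∖ R) ≤ 10^((n - |R|)/5).
-- For a vertex v of degree d ≥ 4 one distinguishes v ∉ S, v isolated in G[S], and v matched to a
-- neighbour u. The second case cannot occur when some neighbour u has N[u] ⊆ N[v], because u could be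
-- added; if N[u] ⊈ N[v] then the third case removes at least d + 2 vertices. The sum is below 10^(n/5)
-- unless d = 4 and N[v] is a component, and the graphs on five vertices with a universal vertex are
-- checked one by one: only K₅ minus a matching survives.
-- When all degrees are at most 3, the graph is revealed step by step around a vertex of minimum degree,
-- and in each of finitely many local configurations a computed case distinction gives a sum below 1.
-- So equality forces a component K₅ minus a matching. Its maximal dissociation sets are the ten pairs of
-- vertices, hence it multiplies φ by 10.
module Submission where

open import Defs hiding (sym)
open import Data.Bool using (Bool; true; false; T; _∧_; _∨_; not; if_then_else_)
import Data.Bool as Bool
open import Data.Bool.Properties using (T?; T-≡)
open import Data.Empty using (⊥; ⊥-elim)
open import Data.Fin using (Fin; zero; suc)
import Data.Fin as Fin
import Data.Fin.Properties as Fin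
open import Data.Fin.Subset using (Subset; _∈_; _∉_; _∪_; _─_; _⊆_; _⊂_; ⁅_⁆; inside; outside; ∣_∣)
open import Data.Fin.Subset.Properties
open import Data.List using (List; []; _∷_; _++_; map; filter; length; allFin; cartesianProduct)
open import Data.Nat.ListAction using (sum)
import Data.List.Properties as List
open import Data.List.Membership.Propositional using (find) renaming (_∈_ to _∈ₗ_; _∉_ to _∉ₗ_)
open import Data.List.Membership.Propositional.Properties
import Data.List.Membership.DecPropositional as DecMembership
open import Data.List.Relation.Unary.Any as Any using (Any; here; there)
open import Data.List.Relation.Unary.All as All using (All; []; _∷_)
open import Data.List.Relation.Unary.All.Properties using (¬All⇒Any¬)
open import Data.List.Relation.Unary.AllPairs as AllPairs using (AllPairs; []; _∷_)
open import Data.List.Relation.Unary.Unique.Propositional using (Unique)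
import Data.List.Relation.Unary.Unique.Propositional.Properties as Unique
open import Data.Maybe using (Maybe; just; nothing)
open import Data.Nat
open import Data.Nat.Divisibility using (_∣_; divides)
open import Data.Nat.Properties
open import Data.Nat.DivMod using (m≡m%n+[m/n]*n; m%n<n)
open import Data.Nat.Solver using (module +-*-Solver)
open import Data.Product.Properties using () renaming (≡-dec to ×-≡-dec)
open import Data.Product using (_×_; _,_; ∃; ∃₂; ∃-syntax; Σ; proj₁; proj₂)
open import Data.Sum using (_⊎_; inj₁; inj₂; [_,_]′)
open import Data.Vec using (Vec; []; _∷_; tabulate; lookup; replicate; _[_]≔_; _∷ʳ_; init)
import Data.Vec.Properties as Vec
open import Function using (_∘_; id)
open import Function.Bundles using (_⇔_; mk⇔; Equivalence)
open import Relation.Binary.PropositionalEquality hiding ([_])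
open import Relation.Nullary using (¬_; Dec; yes; no; does; contradiction)
open import Relation.Nullary.Decidable using (toWitness; _×-dec_; _⊎-dec_; _→-dec_; ¬?; decidable-stable; map′)
open import Relation.Unary using (Decidable)

-- The number 10^(n/5) is irrational unless 5 divides n, so all bounds are kept in the integers:
-- `F n` stands for K · 10^(n/5), rounded down. The induction therefore proves a slightly stronger
-- claim, φ · K ≤ F n, and each branching inequality needs enough slack to survive the rounding. At
-- multiples of 5, where equality has to be reached, `F` is exact. Five steps multiply `F` by 10, so
-- an inequality between its values only has to be checked for the five residues. Deleting vertices
-- never renames the others: an induced subgraph is a duplicate-free list `A` of vertices of one
-- ambient graph. An upper bound is a list that contains all the sets in question, a lower bound a
-- duplicate-free list of such sets. Since equality has to be characterised, strictness travels with
-- the bound: the induction ends in a bound strictly below `F`, or in a decomposition into copies of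
-- K₅ minus a matching.

-- Duplicate-free lists and finite subsets

module _ {A : Set} where

  ∈-remove : ∀ {x : A} ys → x ∈ₗ ys → ∃ λ zs →
    (length ys ≡ suc (length zs)) × (∀ {z} → z ∈ₗ ys → z ≢ x → z ∈ₗ zs)
  ∈-remove (y ∷ ys) (here refl) = ys , refl ,
    λ { (here p) z≢x → contradiction p z≢x ; (there p) _ → p }
  ∈-remove (y ∷ ys) (there p) with ∈-remove ys p
  ... | zs , eq , keep = y ∷ zs , cong suc eq ,
    λ { (here q) _ → here q ; (there q) z≢x → there (keep q z≢x) }

  unique-⊆⇒length≤ : ∀ {xs ys : List A} → Unique xs →
    (∀ {x} → x ∈ₗ xs → x ∈ₗ ys) → length xs ≤ length ys
  unique-⊆⇒length≤ [] _ = z≤n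
  unique-⊆⇒length≤ {x ∷ xs} {ys} (x∉xs ∷ xs!) xs⊆ys with ∈-remove ys (xs⊆ys (here refl))
  ... | zs , eq , keep = subst (suc (length xs) ≤_) (sym eq)
    (s≤s (unique-⊆⇒length≤ xs! λ p →
      keep (xs⊆ys (there p)) λ { refl → All.lookup x∉xs p refl }))

  ++-unique : ∀ {xs ys : List A} → Unique xs → Unique ys →
    (∀ {x} → x ∈ₗ xs → x ∈ₗ ys → ⊥) → Unique (xs ++ ys)
  ++-unique xs! ys! disj = Unique.++⁺ xs! ys! λ (p , q) → disj p q

module _ {n : ℕ} where

  fromDec : ∀ {P : Fin n → Set} → Decidable P → Subset n
  fromDec P? = tabulate (does ∘ P?)

  module _ {P : Fin n → Set} {P? : Decidable P} where

    ∈-fromDec⁺ : ∀ {x} → P x → x ∈ fromDec P?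
    ∈-fromDec⁺ {x} p = Vec.lookup⇒[]= x _ (trans (Vec.lookup∘tabulate _ x) (go (P? x)))
      where
      go : (d : Dec (P x)) → does d ≡ true
      go (yes _) = refl
      go (no ¬p) = contradiction p ¬p

    ∈-fromDec⁻ : ∀ {x} → x ∈ fromDec P? → P x
    ∈-fromDec⁻ {x} q = go (P? x) (trans (sym (Vec.lookup∘tabulate _ x)) (Vec.[]=⇒lookup q))
      where
      go : (d : Dec (P x)) → does d ≡ true → P x
      go (yes p) _ = p

  x∈p─q⁻ : ∀ {x} (p q : Subset n) → x ∈ p ─ q → x ∈ p × x ∉ q
  x∈p─q⁻ p q x∈ = p─q⊆p p q x∈ , λ x∈q → x∈p⇒x∉∁p x∈q (help p q x∈)
    where
    help : ∀ {m x} (p q : Subset m) → x ∈ p ─ q → x ∈ Data.Fin.Subset.∁ q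
    help (_ ∷ _) (outside ∷ _) Data.Vec.here = Data.Vec.here
    help (_ ∷ p) (outside ∷ q) (Data.Vec.there r) = Data.Vec.there (help p q r)
    help (_ ∷ p) (inside ∷ q) (Data.Vec.there r) = Data.Vec.there (help p q r)

allSubsets-complete : ∀ {n} (S : Subset n) → S ∈ₗ allSubsets n
allSubsets-complete [] = here refl
allSubsets-complete {suc n} (inside ∷ S) = ∈-++⁺ˡ (∈-map⁺ (inside ∷_) (allSubsets-complete S))
allSubsets-complete {suc n} (outside ∷ S) =
  ∈-++⁺ʳ (map (inside ∷_) (allSubsets n)) (∈-map⁺ (outside ∷_) (allSubsets-complete S))

allSubsets-unique : ∀ n → Unique (allSubsets n)
allSubsets-unique zero = [] ∷ []
allSubsets-unique (suc n) = ++-unique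
  (Unique.map⁺ Vec.∷-injectiveʳ (allSubsets-unique n))
  (Unique.map⁺ Vec.∷-injectiveʳ (allSubsets-unique n))
  λ p q → disj (∈-map⁻ _ p) (∈-map⁻ _ q)
  where
  disj : ∀ {S : Subset (suc n)} → ∃ (λ T → T ∈ₗ allSubsets n × S ≡ inside ∷ T) →
    ∃ (λ T → T ∈ₗ allSubsets n × S ≡ outside ∷ T) → ⊥
  disj (_ , _ , refl) (_ , _ , ())

-- Integer approximations of powers of 10^(1/5)

K : ℕ
K = 1000000

-- A scaled, slightly rounded-down version of 10 ^ (n / 5), exact when 5 divides n.
F : ℕ → ℕ
F 0 = 1000000
F 1 = 1584893
F 2 = 2511886
F 3 = 3981071
F 4 = 6309573
F (suc (suc (suc (suc (suc n))))) = F n * 10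

m*n*o≡m*o*n : ∀ m n o → m * n * o ≡ m * o * n
m*n*o≡m*o*n m n o = trans (*-assoc m n o) (trans (cong (m *_) (*-comm n o)) (sym (*-assoc m o n)))

-- Passing from n to n + 5 multiplies both sides by 10, so the five residues decide everything, and
-- they are settled by evaluation. The recursion runs with `n + r` because that sum unfolds along
-- `n`.
F-ratio : ∀ r a b → T (F 0 * a <ᵇ F r * b) → T (F 1 * a <ᵇ F (1 + r) * b) →
  T (F 2 * a <ᵇ F (2 + r) * b) → T (F 3 * a <ᵇ F (3 + r) * b) → T (F 4 * a <ᵇ F (4 + r) * b) →
  ∀ n → F n * a < F (r + n) * b
F-ratio r a b h₀ h₁ h₂ h₃ h₄ n = subst (λ k → F n * a < F k * b) (+-comm n r) (go n)
  where
  go : ∀ n → F n * a < F (n + r) * b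
  go 0 = <ᵇ⇒< (F 0 * a) (F r * b) h₀
  go 1 = <ᵇ⇒< (F 1 * a) (F (1 + r) * b) h₁
  go 2 = <ᵇ⇒< (F 2 * a) (F (2 + r) * b) h₂
  go 3 = <ᵇ⇒< (F 3 * a) (F (3 + r) * b) h₃
  go 4 = <ᵇ⇒< (F 4 * a) (F (4 + r) * b) h₄
  go (suc (suc (suc (suc (suc n))))) =
    subst₂ _<_ (m*n*o≡m*o*n (F n) a 10) (m*n*o≡m*o*n (F (n + r)) b 10) (*-monoˡ-< 10 (go n))

F-3/2 : ∀ n → F n * 3 < F (suc n) * 2
F-3/2 = F-ratio 1 3 2 _ _ _ _ _

-- The fractions 14/9 and 11/7 are exactly what the two branching sums at a vertex of degree four
-- require; both lie just below 10^(1/5) ≈ 1.5849.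
F-14/9 : ∀ n → F n * 14 < F (suc n) * 9
F-14/9 = F-ratio 1 14 9 _ _ _ _ _

F-11/7 : ∀ n → F n * 11 < F (suc n) * 7
F-11/7 = F-ratio 1 11 7 _ _ _ _ _

F-step : ∀ n → F n < F (suc n)
F-step n = subst₂ _<_ (*-identityʳ (F n)) (*-identityʳ (F (suc n))) (F-ratio 1 1 1 _ _ _ _ _ n)

F-mono : ∀ {m n} → m ≤ n → F m ≤ F n
F-mono {m} m≤n = go (≤⇒≤′ m≤n)
  where
  go : ∀ {n} → m ≤′ n → F m ≤ F n
  go ≤′-refl = ≤-refl
  go (≤′-step {n} p) = ≤-trans (go p) (<⇒≤ (F-step n))

F-pos : ∀ n → 0 < F n
F-pos n = ≤-trans (<ᵇ⇒< 0 (F 0) _) (F-mono {0} {n} z≤n)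

^-distribˡ-* : ∀ k m n → (m * n) ^ k ≡ m ^ k * n ^ k
^-distribˡ-* zero m n = refl
^-distribˡ-* (suc k) m n =
  trans (cong (m * n *_) (^-distribˡ-* k m n)) ([m*n]*[o*p]≡[m*o]*[n*p] m n (m ^ k) (n ^ k))

^5-step : ∀ n b x k → x ^ 5 ≤ b ^ n * k → (x * b) ^ 5 ≤ b ^ (suc (suc (suc (suc (suc n))))) * k
^5-step n b x k h = begin
  (x * b) ^ 5          ≡⟨ ^-distribˡ-* 5 x b ⟩
  x ^ 5 * b ^ 5        ≤⟨ *-monoˡ-≤ (b ^ 5) h ⟩
  b ^ n * k * b ^ 5    ≡⟨ m*n*o≡m*o*n (b ^ n) k (b ^ 5) ⟩
  b ^ n * b ^ 5 * k    ≡⟨ cong (_* k) (*-comm (b ^ n) (b ^ 5)) ⟩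
  b ^ 5 * b ^ n * k    ≡⟨ cong (_* k) (^-distribˡ-+-* b 5 n) ⟨
  b ^ (5 + n) * k      ∎
  where open ≤-Reasoning

-- This is F n ≤ K · 10^(n/5) with the root cleared. It is the link between `F` and the powers of 10
-- in the theorem.
F-power : ∀ n → F n ^ 5 ≤ 10 ^ n * K ^ 5
F-power 0 = ≤ᵇ⇒≤ (F 0 ^ 5) (10 ^ 0 * K ^ 5) _
F-power 1 = ≤ᵇ⇒≤ (F 1 ^ 5) (10 ^ 1 * K ^ 5) _
F-power 2 = ≤ᵇ⇒≤ (F 2 ^ 5) (10 ^ 2 * K ^ 5) _
F-power 3 = ≤ᵇ⇒≤ (F 3 ^ 5) (10 ^ 3 * K ^ 5) _
F-power 4 = ≤ᵇ⇒≤ (F 4 ^ 5) (10 ^ 4 * K ^ 5) _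
F-power (suc (suc (suc (suc (suc n))))) = ^5-step n 10 (F n) (K ^ 5) (F-power n)

Q : ℕ
Q = 1000000

-- W r / Q is an upper bound for 10 ^ (- r / 5).
W : ℕ → ℕ
W 0 = 1000001
W 1 = 630959
W 2 = 398109
W 3 = 251190
W 4 = 158491
W (suc (suc (suc (suc (suc r))))) = suc (W r / 10)

-- Removing r vertices costs at most the factor W r / Q. The recursive clause of `W` divides by 10
-- and rounds up, which keeps the inequality.
F-W : ∀ r n → F n * Q < F (r + n) * W r
F-W 0 = F-ratio 0 Q (W 0) _ _ _ _ _
F-W 1 = F-ratio 1 Q (W 1) _ _ _ _ _
F-W 2 = F-ratio 2 Q (W 2) _ _ _ _ _
F-W 3 = F-ratio 3 Q (W 3) _ _ _ _ _
F-W 4 = F-ratio 4 Q (W 4) _ _ _ _ _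
F-W (suc (suc (suc (suc (suc r))))) n = <-≤-trans (F-W r n) (round (F (r + n)) (W r))
  where
  round : ∀ x w → x * w ≤ x * 10 * suc (w / 10)
  round x w = begin
    x * w                          ≡⟨ cong (x *_) (m≡m%n+[m/n]*n w 10) ⟩
    x * (w % 10 + w / 10 * 10)     ≤⟨ *-monoʳ-≤ x (+-monoˡ-≤ (w / 10 * 10) (<⇒≤ (m%n<n w 10))) ⟩
    x * (suc (w / 10) * 10)        ≡⟨ cong (x *_) (*-comm (suc (w / 10)) 10) ⟩
    x * (10 * suc (w / 10))        ≡⟨ *-assoc x 10 (suc (w / 10)) ⟨
    x * 10 * suc (w / 10)          ∎
    where open ≤-Reasoning

-- Covers as upper bounds for cardinalities

-- The list may repeat entries and contain foreign ones, so case distinctions become concatenations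
-- and no disjointness has to be shown. The bound is in units of 1 / K, to be comparable with `F`.
record Cover {A : Set} (P : A → Set) (b : ℕ) : Set where
  constructor cover
  field
    list     : List A
    covers   : ∀ {x} → P x → x ∈ₗ list
    length≤  : length list * K ≤ b
open Cover

module _ {A : Set} {P : A → Set} where

  cover-≤ : ∀ {b c} → b ≤ c → Cover P b → Cover P c
  cover-≤ b≤c (cover xs cov len) = cover xs cov (≤-trans len b≤c)

  cover-⊆ : ∀ {Q : A → Set} {b} → (∀ {x} → P x → Q x) → Cover Q b → Cover P b
  cover-⊆ P⊆Q (cover xs cov len) = cover xs (cov ∘ P⊆Q) len

  cover-⊥ : (∀ {x} → ¬ P x) → Cover P 0
  cover-⊥ ¬P = cover [] (λ p → contradiction p ¬P) z≤n

  cover-⊎ : ∀ {Q R : A → Set} {b c} → (∀ {x} → P x → Q x ⊎ R x) →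
    Cover Q b → Cover R c → Cover P (b + c)
  cover-⊎ {b = b} {c} split (cover xs cov len) (cover ys cov′ len′) = cover (xs ++ ys)
    (λ p → [ ∈-++⁺ˡ ∘ cov , ∈-++⁺ʳ xs ∘ cov′ ]′ (split p))
    (subst (_≤ b + c) (sym (trans (cong (_* K) (List.length-++ xs)) (*-distribʳ-+ K (length xs) (length ys))))
      (+-mono-≤ len len′))

  cover-image : ∀ {B : Set} {Q : B → Set} {b} (g : B → A) →
    (∀ {x} → P x → ∃ λ y → Q y × x ≡ g y) → Cover Q b → Cover P b
  cover-image g pre (cover ys cov len) = cover (map g ys)
    (λ p → let y , q , eq = pre p in subst (_∈ₗ map g ys) (sym eq) (∈-map⁺ g (cov q)))
    (subst (λ l → l * K ≤ _) (sym (List.length-map g ys)) len)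

module _ {A I : Set} {P : I → A → Set} where

  cover-Any : ∀ (b : I → ℕ) is → (∀ {i} → i ∈ₗ is → Cover (P i) (b i)) →
    Cover (λ x → ∃ λ i → i ∈ₗ is × P i x) (sum (map b is))
  cover-Any b [] _ = cover-⊥ λ ()
  cover-Any b (i ∷ is) h = cover-⊎
    (λ { (_ , here refl , p) → inj₁ p ; (j , there q , p) → inj₂ (j , q , p) })
    (h (here refl)) (cover-Any b is (h ∘ there))

-- Dissociation sets of induced subgraphs

module Dissociation {n : ℕ} (G : Graph n) where

  V : Set
  V = Fin n

  infix 4 _~_
  _~_ : V → V → Set
  u ~ v = T (Adj G u v)

  _~?_ : ∀ u v → Dec (u ~ v)
  u ~? v = T? (Adj G u v)

  ~-sym : ∀ {u v} → u ~ v → v ~ u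
  ~-sym {u} {v} = subst T (Graph.sym G u v)

  ~-irrefl : ∀ {v} → ¬ v ~ v
  ~-irrefl {v} = subst T (Graph.loopless G v)

  Dis : Subset n → Set
  Dis S = ∀ {v a b} → v ∈ S → a ∈ S → b ∈ S → v ~ a → v ~ b → a ≡ b

  -- `A` lists the vertices of the induced subgraph. Testing single vertices suffices for maximality
  -- because `Dis` passes to subsets.
  record Max (A : List V) (S : Subset n) : Set where
    field
      inside-A : ∀ {x} → x ∈ S → x ∈ₗ A
      dis      : Dis S
      maximal  : ∀ {x} → x ∈ₗ A → Dis (S ∪ ⁅ x ⁆) → x ∈ S
  open Max public

  _∖_ : List V → Subset n → List V
  A ∖ R = filter (λ x → ¬? (x ∈? R)) A

  ∈-∖⁺ : ∀ {A} R {x} → x ∈ₗ A → x ∉ R → x ∈ₗ A ∖ R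
  ∈-∖⁺ R = ∈-filter⁺ (λ x → ¬? (x ∈? R))

  ∈-∖⁻ : ∀ A R {x} → x ∈ₗ A ∖ R → x ∈ₗ A × x ∉ R
  ∈-∖⁻ A R = ∈-filter⁻ (λ x → ¬? (x ∈? R)) {xs = A}

  ∖-unique : ∀ {A} R → Unique A → Unique (A ∖ R)
  ∖-unique R = Unique.filter⁺ (λ x → ¬? (x ∈? R))

  length-∖ : ∀ {A R} xs → Unique A → Unique xs → (∀ {x} → x ∈ₗ xs → x ∈ₗ A × x ∈ R) →
    length xs + length (A ∖ R) ≤ length A
  length-∖ {A} {R} xs A! xs! xs⊆ = subst (_≤ length A) (List.length-++ xs)
    (unique-⊆⇒length≤ (++-unique xs! (∖-unique R A!) λ p q → proj₂ (∈-∖⁻ A R q) (proj₂ (xs⊆ p)))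
      λ p → [ proj₁ ∘ xs⊆ , proj₁ ∘ ∈-∖⁻ A R ]′ (∈-++⁻ xs p))

  x∈S∪⁅y⁆⁻ : ∀ {S : Subset n} {x y} → x ∈ S ∪ ⁅ y ⁆ → x ∈ S ⊎ x ≡ y
  x∈S∪⁅y⁆⁻ {S} {x} {y} p = [ inj₁ , inj₂ ∘ x∈⁅y⁆⇒x≡y y ]′ (x∈p∪q⁻ S ⁅ y ⁆ p)

  record Separates (A : List V) (D R S : Subset n) : Set where
    field
      D⊆R   : ∀ {x} → x ∈ D → x ∈ R
      D⊆S   : ∀ {x} → x ∈ D → x ∈ S
      S∩R⊆D : ∀ {x} → x ∈ S → x ∈ R → x ∈ D
      N[D]  : ∀ {x y} → x ∈ D → y ∈ₗ A → x ~ y → y ∈ R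

  module _ {A : List V} {D R S : Subset n} (S-max : Max A S) (sep : Separates A D R S) where
    open Separates sep

    -- With `D` and `R` fixed, this recovers S from its part outside R, so no two sets of the same
    -- case are confused.
    separate-eq : S ≡ (S ─ R) ∪ D
    separate-eq = ⊆-antisym to from
      where
      to : S ⊆ (S ─ R) ∪ D
      to {x} x∈S with x ∈? R
      ... | yes x∈R = x∈p∪q⁺ (inj₂ (S∩R⊆D x∈S x∈R))
      ... | no  x∉R = x∈p∪q⁺ (inj₁ (x∈p∧x∉q⇒x∈p─q x∈S x∉R))
      from : (S ─ R) ∪ D ⊆ S
      from p = [ proj₁ ∘ x∈p─q⁻ S R , D⊆S ]′ (x∈p∪q⁻ (S ─ R) D p)

    -- A vertex x outside R has no neighbour in D, because R contains all neighbours of D. Hence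
    -- adding x to S creates no conflict at D, and if x can be added to `S ─ R` it can be added to
    -- S.
    separate-max : Max (A ∖ R) (S ─ R)
    separate-max = record
      { inside-A = λ p → let x∈S , x∉R = x∈p─q⁻ S R p in ∈-∖⁺ R (inside-A S-max x∈S) x∉R
      ; dis      = λ v a b → dis S-max (p─q⊆p S R v) (p─q⊆p S R a) (p─q⊆p S R b)
      ; maximal  = mx
      }
      where
      mx : ∀ {x} → x ∈ₗ A ∖ R → Dis ((S ─ R) ∪ ⁅ x ⁆) → x ∈ S ─ R
      mx {x} x∈ dis′ = x∈p∧x∉q⇒x∈p─q (maximal S-max x∈A dis″) x∉R
        where
        x∈A = proj₁ (∈-∖⁻ A R x∈)
        x∉R = proj₂ (∈-∖⁻ A R x∈)
        A∋ : ∀ {y} → y ∈ S ∪ ⁅ x ⁆ → y ∈ₗ A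
        A∋ p with x∈S∪⁅y⁆⁻ p
        ... | inj₁ y∈S = inside-A S-max y∈S
        ... | inj₂ refl = x∈A
        D∋ : ∀ {y} → y ∈ S ∪ ⁅ x ⁆ → y ∈ R → y ∈ D
        D∋ p y∈R with x∈S∪⁅y⁆⁻ p
        ... | inj₁ y∈S = S∩R⊆D y∈S y∈R
        ... | inj₂ refl = contradiction y∈R x∉R
        outer : ∀ {y} → y ∈ S ∪ ⁅ x ⁆ → y ∉ D → y ∈ (S ─ R) ∪ ⁅ x ⁆
        outer p y∉D with x∈S∪⁅y⁆⁻ p
        ... | inj₁ y∈S = x∈p∪q⁺ (inj₁ (x∈p∧x∉q⇒x∈p─q y∈S (y∉D ∘ S∩R⊆D y∈S)))
        ... | inj₂ refl = x∈p∪q⁺ (inj₂ (x∈⁅x⁆ x))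
        dis″ : Dis (S ∪ ⁅ x ⁆)
        dis″ {v} {a} {b} v∈ a∈ b∈ v~a v~b with v ∈? D
        ... | yes v∈D = dis S-max (D⊆S v∈D) (nb a∈ v~a) (nb b∈ v~b) v~a v~b
          where
          nb : ∀ {y} → y ∈ S ∪ ⁅ x ⁆ → v ~ y → y ∈ S
          nb y∈ v~y = D⊆S (D∋ y∈ (N[D] v∈D (A∋ y∈) v~y))
        ... | no v∉D = dis′ (outer v∈ v∉D) (outer a∈ (nb v~a)) (outer b∈ (nb v~b)) v~a v~b
          where
          nb : ∀ {y} → v ~ y → y ∉ D
          nb v~y y∈D = v∉D (D∋ v∈ (N[D] y∈D (A∋ v∈) (~-sym v~y)))

  separate-cover : ∀ {A D R P b} → (∀ {S} → P S → Max A S × Separates A D R S) →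
    Cover (Max (A ∖ R)) b → Cover P b
  separate-cover {D = D} {R} sep = cover-image (_∪ D) λ {S} p →
    let mx , sp = sep p in S ─ R , separate-max mx sp , separate-eq mx sp

  Below : List V → Set
  Below A = ∀ B → Unique B → length B < length A → Cover (Max B) (F (length B))

  -- It is enough to exhibit some distinct vertices `xs` of A in R: if R contains more, fewer
  -- vertices remain and `F` is monotone. Having at least one makes the induction hypothesis
  -- applicable.
  below-cover : ∀ {A D R P} → Unique A → Below A → ∀ xs → Unique xs → 0 < length xs →
    (∀ {x} → x ∈ₗ xs → x ∈ₗ A × x ∈ R) →
    (∀ {S} → P S → Max A S × Separates A D R S) → Cover P (F (length A ∸ length xs))
  below-cover {A} {R = R} A! ih xs xs! pos xs⊆ sep = separate-cover sep
    (cover-≤ (F-mono (m+n≤o⇒n≤o∸m (length xs) len)) (ih (A ∖ R) (∖-unique R A!) (≤-trans (+-monoˡ-≤ _ pos) len)))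
    where
    len = length-∖ {A} {R} xs A! xs! xs⊆
    m+n≤o⇒n≤o∸m : ∀ m {n o} → m + n ≤ o → n ≤ o ∸ m
    m+n≤o⇒n≤o∸m m {n} p = subst (_≤ _) (m+n∸m≡n m n) (∸-monoˡ-≤ m p)

-- Branching on partially revealed graphs

trues : ∀ {m} → (Fin m → Bool) → List (Fin m)
trues p = filter (λ i → T? (p i)) (allFin _)

count : ∀ {m} → (Fin m → Bool) → ℕ
count = length ∘ trues

larger : ℕ → ℕ → ℕ
larger a b = if a ≤ᵇ b then b else a

maxOf : ∀ {m} → (Fin m → ℕ) → ℕ
maxOf {zero}  g = 0
maxOf {suc m} g = larger (g zero) (maxOf (g ∘ suc))

maxOf-attained : ∀ {m} (g : Fin m → ℕ) → maxOf g ≡ 0 ⊎ ∃ λ i → maxOf g ≡ g i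
maxOf-attained {zero}  g = inj₁ refl
maxOf-attained {suc m} g with g zero ≤ᵇ maxOf (g ∘ suc)
... | false = inj₂ (zero , refl)
... | true with maxOf-attained (g ∘ suc)
...   | inj₁ eq = inj₁ eq
...   | inj₂ (i , eq) = inj₂ (suc i , eq)

lastTrue : ∀ {m} → (Fin m → Bool) → Maybe (Fin m)
lastTrue {zero}  p = nothing
lastTrue {suc m} p with lastTrue (p ∘ suc)
... | just i  = just (suc i)
... | nothing = if p zero then just zero else nothing

lastMax : ∀ {m} → (Fin m → ℕ) → Maybe (Fin m)
lastMax g = lastTrue λ i → (0 <ᵇ g i) ∧ does (Fin.all? λ j → g j ≤? g i)

-- A graph on Fin m, built by adding vertices one at a time: the newest vertex is zero,
-- and the vector lists its adjacencies to the older ones.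
infixl 5 _▸_
data Pattern : ℕ → Set where
  ∅   : Pattern 0
  _▸_ : ∀ {m} → Pattern m → Vec Bool m → Pattern (suc m)

adj : ∀ {m} → Pattern m → Fin m → Fin m → Bool
adj (P ▸ r) zero    zero    = false
adj (P ▸ r) zero    (suc j) = lookup r j
adj (P ▸ r) (suc i) zero    = lookup r i
adj (P ▸ r) (suc i) (suc j) = adj P i j

data Status : Set where
  chosen rejected undecided : Status

isChosen isRejected isUndecided : Status → Bool
isChosen chosen = true
isChosen _      = false
isRejected rejected = true
isRejected _        = false
isUndecided undecided = true
isUndecided _         = false

-- Branching on which vertices of a pattern P lie in a maximal dissociation set of an
-- ambient graph. Vertices marked in cl have all their neighbours inside P, and every
-- vertex has degree at least d₀.
module Branching {m : ℕ} (P : Pattern m) (cl : Vec Bool m) (d₀ : ℕ) where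

  Adj! : Fin m → Fin m → Set
  Adj! x y = T (adj P x y)

  adj? : ∀ x y → Dec (Adj! x y)
  adj? x y = T? (adj P x y)

  Closed : Fin m → Set
  Closed x = T (lookup cl x)

  closed? : ∀ x → Dec (Closed x)
  closed? x = T? (lookup cl x)

  deg : Fin m → ℕ
  deg x = count (adj P x)

  module _ (st : Vec Status m) where

    In Out : Fin m → Set
    In x  = T (isChosen (lookup st x))
    Out x = T (isRejected (lookup st x))

    in? : ∀ x → Dec (In x)
    in? x = T? (isChosen (lookup st x))

    out? : ∀ x → Dec (Out x)
    out? x = T? (isRejected (lookup st x))

    Clash : Set
    Clash = ∃ λ x → In x × ∃ λ y → In y × Adj! x y × ∃ λ z → In z × Adj! x z × y ≢ z

    clash? : Dec Clash
    clash? = Fin.any? λ x → in? x ×-dec Fin.any? λ y → in? y ×-dec adj? x y ×-dec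
      Fin.any? λ z → in? z ×-dec adj? x z ×-dec ¬? (y Fin.≟ z)

    -- A certificate that x was rejected wrongly: all its neighbours are known, at most one of them
    -- is chosen, and that one is isolated in S. Then S with x added is still a dissociation set,
    -- against maximality.
    Addable : Fin m → Set
    Addable x = Out x × Closed x ×
      (∀ y → Adj! x y → Out y ⊎ (In y × Closed y × ∀ z → Adj! y z → Out z)) ×
      (∀ y → Adj! x y → In y → ∀ z → Adj! x z → In z → y ≡ z)

    addable? : ∀ x → Dec (Addable x)
    addable? x = out? x ×-dec closed? x ×-dec
      (Fin.all? λ y → adj? x y →-dec
        (out? y ⊎-dec (in? y ×-dec closed? y ×-dec Fin.all? λ z → adj? y z →-dec out? z))) ×-dec
      (Fin.all? λ y → adj? x y →-dec (in? y →-dec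
        Fin.all? λ z → adj? x z →-dec (in? z →-dec (y Fin.≟ z))))

    Infeasible : Set
    Infeasible = Clash ⊎ ∃ Addable

    infeasible? : Dec Infeasible
    infeasible? = clash? ⊎-dec Fin.any? addable?

    -- The component of G[S] at x is completely known. An edge of G[S] cannot grow, whatever lies
    -- outside the pattern; isolation can only be certified when no neighbour lies outside.
    Settled : Fin m → Set
    Settled x = In x × ((∃ λ y → Adj! x y × In y) ⊎ (Closed x × ∀ y → Adj! x y → Out y))

    settled? : ∀ x → Dec (Settled x)
    settled? x = in? x ×-dec (Fin.any? (λ y → adj? x y ×-dec in? y) ⊎-dec
      (closed? x ×-dec Fin.all? λ y → adj? x y →-dec out? y))

    Removed : Fin m → Set
    Removed x = Out x ⊎ Settled x ⊎ (∃ λ y → Adj! x y × Settled y)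

    removed? : ∀ x → Dec (Removed x)
    removed? x = out? x ⊎-dec settled? x ⊎-dec Fin.any? λ y → adj? x y ×-dec settled? y

    -- A settled vertex x has at least d₀ ∸ deg x neighbours outside the pattern.
    deficiency : Fin m → ℕ
    deficiency x = if does (settled? x) then d₀ ∸ deg x else 0

    -- Different settled vertices may share their neighbours outside the pattern, hence a maximum
    -- and not a sum of the deficiencies.
    #removed : ℕ
    #removed = count (does ∘ removed?) + maxOf deficiency

    -- A heuristic order, any choice being sound: deciding the neighbours of chosen vertices is what
    -- settles those vertices.
    pick : Maybe (Fin m)
    pick with lastTrue (λ y → isUndecided (lookup st y) ∧ does (Fin.any? λ x → adj? y x ×-dec in? x))
    ... | just y  = just y
    ... | nothing = lastTrue λ y → isUndecided (lookup st y)

  -- The minimum of l and a + b. Comparing l with a alone comes before, so that the second branch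
  -- need not be evaluated when the first is already too expensive.
  smaller : ℕ → ℕ → ℕ → ℕ
  smaller l a b = if l ≤ᵇ a then l else if l ≤ᵇ a + b then l else a + b

  -- In units of 1 / Q, the share of 10 ^ (n / 5) that bounds the number of maximal dissociation
  -- sets compatible with the statuses.
  weight : ℕ → Vec Status m → ℕ
  weight k st with does (infeasible? st)
  weight k       st | true  = 0
  weight zero    st | false = W (#removed st)
  weight (suc k) st | false with pick st
  ... | nothing = W (#removed st)
  ... | just x  = smaller (W (#removed st))
    (weight k (st [ x ]≔ chosen)) (weight k (st [ x ]≔ rejected))

allRows : ∀ {m} → (Fin m → Bool) → (Vec Bool m → Bool) → Bool
allRows {zero}  a k = k []
allRows {suc m} a k = allRows (a ∘ suc) (k ∘ (false ∷_)) ∧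
  (if a zero then allRows (a ∘ suc) (k ∘ (true ∷_)) else true)

-- Reveals the graph around the root, a vertex of minimum degree, until the branching weight drops
-- below Q; configurations with a vertex of degree above 3 or below the root's are discarded.
mutual

  explore : ℕ → ∀ {m} → Pattern m → Vec Bool m → Fin m → Bool
  explore zero P cl root = false
  explore (suc k) {m} P cl root =
    does (Fin.any? λ x → closed? x ×-dec (deg x <? d₀)) ∨
    does (Fin.any? λ x → 3 <? deg x) ∨
    (weight (suc m) (replicate m undecided) <ᵇ Q) ∨
    expand k P cl root (lastMax λ x → if lookup cl x then 0 else suc (deg x))
    where
    d₀ : ℕ
    -- The degree of the root inside the pattern is a lower bound for its true degree, the minimum
    -- degree of the graph; it improves as neighbours of the root are revealed.
    d₀ = count (adj P root)
    open Branching P cl d₀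

  expand : ℕ → ∀ {m} → Pattern m → Vec Bool m → Fin m → Maybe (Fin m) → Bool
  expand k P cl root nothing  = false
  expand k P cl root (just x) = explore k P (cl [ x ]≔ true) root ∧
    -- Either x is closed, or it has a neighbour outside the pattern. Such a neighbour can be
    -- adjacent to open vertices only, which limits the rows to be tried.
    allRows (λ y → not (lookup cl y)) λ r → not (lookup r x) ∨ explore k (P ▸ r) (false ∷ cl) (suc root)

-- Soundness of the branching bound

T-split : ∀ {a b} → T (a ∧ b) → T a × T b
T-split {true} p = _ , p

¬T-not : ∀ {b} → T (not b) → ¬ T b
¬T-not {true} ()
¬T-not {false} _ ()

does-T : ∀ {P : Set} (P? : Dec P) → T (does P?) → P
does-T (yes p) _ = p

does-true : ∀ {P : Set} (P? : Dec P) → does P? ≡ true → P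
does-true (yes p) _ = p

if-does : ∀ {P : Set} (P? : Dec P) a →
  ((if does P? then a else 0) ≡ 0) ⊎ (P × (if does P? then a else 0) ≡ a)
if-does (yes p) a = inj₂ (p , refl)
if-does (no _)  a = inj₁ refl

∈-trues⁺ : ∀ {m} {p : Fin m → Bool} {i} → T (p i) → i ∈ₗ trues p
∈-trues⁺ {p = p} = ∈-filter⁺ (λ i → T? (p i)) (∈-allFin _)

∈-trues⁻ : ∀ {m} {p : Fin m → Bool} {i} → i ∈ₗ trues p → T (p i)
∈-trues⁻ {p = p} q = proj₂ (∈-filter⁻ (λ i → T? (p i)) {xs = allFin _} q)

trues-unique : ∀ {m} (p : Fin m → Bool) → Unique (trues p)
trues-unique p = Unique.filter⁺ (λ i → T? (p i)) (Unique.allFin⁺ _)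

module Neighbours {n : ℕ} (G : Graph n) (A : List (Fin n)) where
  open Dissociation G

  nbrs : V → List V
  nbrs x = filter (x ~?_) A

  degree : V → ℕ
  degree = length ∘ nbrs

  ∈-nbrs⁺ : ∀ {x y} → y ∈ₗ A → x ~ y → y ∈ₗ nbrs x
  ∈-nbrs⁺ {x} = ∈-filter⁺ (x ~?_)

  ∈-nbrs⁻ : ∀ {x y} → y ∈ₗ nbrs x → y ∈ₗ A × x ~ y
  ∈-nbrs⁻ {x} = ∈-filter⁻ (x ~?_) {xs = A}

  nbrs-unique : Unique A → ∀ x → Unique (nbrs x)
  nbrs-unique A! x = Unique.filter⁺ (x ~?_) A!

  record Emb {m} (P : Pattern m) (cl : Vec Bool m) : Set where
    field
      f        : Fin m → V
      f-inj    : ∀ {i j} → f i ≡ f j → i ≡ j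
      f∈A      : ∀ i → f i ∈ₗ A
      f-adj    : ∀ i j → Adj G (f i) (f j) ≡ adj P i j
      f-closed : ∀ {i} → T (lookup cl i) → ∀ {y} → y ∈ₗ A → f i ~ y → ∃ λ j → f j ≡ y

    ~⇒adj : ∀ {i j} → f i ~ f j → T (adj P i j)
    ~⇒adj {i} {j} = subst T (f-adj i j)

    adj⇒~ : ∀ {i j} → T (adj P i j) → f i ~ f j
    adj⇒~ {i} {j} = subst T (sym (f-adj i j))

    image? : Decidable λ y → ∃ λ i → f i ≡ y
    image? y = Fin.any? λ i → f i Fin.≟ y

    map-f-unique : ∀ {is} → Unique is → Unique (map f is)
    map-f-unique = Unique.map⁺ f-inj

    outer : Fin m → List V
    outer x = filter (λ y → ¬? (image? y)) (nbrs (f x))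

    ∈-outer⁻ : ∀ {x y} → y ∈ₗ outer x → (y ∈ₗ A × f x ~ y) × ¬ ∃ λ i → f i ≡ y
    ∈-outer⁻ {x} p = let q , r = ∈-filter⁻ (λ y → ¬? (image? y)) {xs = nbrs (f x)} p in ∈-nbrs⁻ q , r

    outer-unique : Unique A → ∀ x → Unique (outer x)
    outer-unique A! x = Unique.filter⁺ (λ y → ¬? (image? y)) (nbrs-unique A! (f x))

    inner-degree : Unique A → ∀ x → count (adj P x) ≤ degree (f x)
    inner-degree A! x = subst (_≤ degree (f x)) (List.length-map f (trues (adj P x)))
      (unique-⊆⇒length≤ (map-f-unique (trues-unique (adj P x))) λ p →
        let i , q , eq = ∈-map⁻ f p in
        subst (_∈ₗ nbrs (f x)) (sym eq) (∈-nbrs⁺ (f∈A i) (adj⇒~ (∈-trues⁻ q))))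

    outer-degree : Unique A → ∀ x → degree (f x) ∸ count (adj P x) ≤ length (outer x)
    outer-degree A! x = m≤n+o⇒m∸n≤o (degree (f x)) (count (adj P x))
      (subst (degree (f x) ≤_)
        (trans (List.length-++ (map f (trues (adj P x)))) (cong (_+ length (outer x)) (List.length-map f (trues (adj P x)))))
        (unique-⊆⇒length≤ (nbrs-unique A! (f x)) mem))
      where
      mem : ∀ {y} → y ∈ₗ nbrs (f x) → y ∈ₗ map f (trues (adj P x)) ++ outer x
      mem {y} p with image? y
      ... | yes (i , refl) = ∈-++⁺ˡ (∈-map⁺ f (∈-trues⁺ (~⇒adj (proj₂ (∈-nbrs⁻ p)))))
      ... | no ∄i = ∈-++⁺ʳ (map f (trues (adj P x))) (∈-filter⁺ (λ y → ¬? (image? y)) p ∄i)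

    closed-degree : Unique A → ∀ {x} → T (lookup cl x) → degree (f x) ≤ count (adj P x)
    closed-degree A! {x} c = subst (degree (f x) ≤_) (List.length-map f (trues (adj P x)))
      (unique-⊆⇒length≤ (nbrs-unique A! (f x)) λ p → mem p (f-closed c (proj₁ (∈-nbrs⁻ p)) (proj₂ (∈-nbrs⁻ p))))
      where
      mem : ∀ {y} → y ∈ₗ nbrs (f x) → (∃ λ i → f i ≡ y) → y ∈ₗ map f (trues (adj P x))
      mem p (i , refl) = ∈-map⁺ f (∈-trues⁺ (~⇒adj (proj₂ (∈-nbrs⁻ p))))
  open Emb

  module _ {m} {P : Pattern m} {cl : Vec Bool m} (e : Emb P cl) where

    close : ∀ x → (∀ {y} → y ∈ₗ A → f e x ~ y → ∃ λ j → f e j ≡ y) → Emb P (cl [ x ]≔ true)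
    close x h = record
      { f = f e ; f-inj = f-inj e ; f∈A = f∈A e ; f-adj = f-adj e
      ; f-closed = λ {i} c → go i c (i Fin.≟ x)
      }
      where
      go : ∀ i → T (lookup (cl [ x ]≔ true) i) → Dec (i ≡ x) →
        ∀ {y} → y ∈ₗ A → f e i ~ y → ∃ λ j → f e j ≡ y
      go i c (yes refl) = h
      go i c (no i≢x) = f-closed e (subst T (Vec.lookup∘update′ i≢x cl true) c)

    extend : ∀ {y} → y ∈ₗ A → ¬ (∃ λ i → f e i ≡ y) →
      Emb (P ▸ tabulate (λ i → Adj G y (f e i))) (false ∷ cl)
    extend {y} y∈A new = record
      { f = f⁺
      ; f-inj = inj
      ; f∈A = λ { zero → y∈A ; (suc i) → f∈A e i }
      ; f-adj = ad
      ; f-closed = λ {i} → cls {i}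
      }
      where
      f⁺ : Fin (suc m) → V
      f⁺ zero = y
      f⁺ (suc i) = f e i
      inj : ∀ {i j} → f⁺ i ≡ f⁺ j → i ≡ j
      inj {zero} {zero} _ = refl
      inj {zero} {suc j} eq = contradiction (j , sym eq) new
      inj {suc i} {zero} eq = contradiction (i , eq) new
      inj {suc i} {suc j} eq = cong suc (f-inj e eq)
      ad : ∀ i j → Adj G (f⁺ i) (f⁺ j) ≡ adj (P ▸ tabulate (λ i → Adj G y (f e i))) i j
      ad zero zero = Graph.loopless G y
      ad zero (suc j) = sym (Vec.lookup∘tabulate _ j)
      ad (suc i) zero = trans (Graph.sym G (f e i) y) (sym (Vec.lookup∘tabulate _ i))
      ad (suc i) (suc j) = f-adj e i j
      cls : ∀ {i} → T (lookup (false ∷ cl) i) → ∀ {z} → z ∈ₗ A → f⁺ i ~ z → ∃ λ j → f⁺ j ≡ z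
      cls {suc i} c z∈A z~ = let j , eq = f-closed e c z∈A z~ in suc j , eq

  record Weighted (P : Subset n → Set) (w : ℕ) : Set where
    field
      bound    : ℕ
      bounds   : Cover P bound
      bound≤   : bound * Q ≤ F (length A) * w
  open Weighted public

  module WeightSound {m} {P : Pattern m} {cl : Vec Bool m} (e : Emb P cl) {d₀ : ℕ}
    (A! : Unique A) (ih : Below A) (d₀≤ : ∀ {x} → x ∈ₗ A → d₀ ≤ degree x) where
    open Branching P cl d₀

    record Agrees (st : Vec Status m) (S : Subset n) : Set where
      field
        In⇒∈  : ∀ {i} → In st i → f e i ∈ S
        Out⇒∉ : ∀ {i} → Out st i → f e i ∉ S
    open Agrees

    Class : Vec Status m → Subset n → Set
    Class st S = Max A S × Agrees st S

    module _ {st : Vec Status m} {S : Subset n} (S-max : Max A S) (agree : Agrees st S) where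

      ¬clash : ¬ Clash st
      ¬clash (x , x-in , y , y-in , xy , z , z-in , xz , y≢z) =
        y≢z (f-inj e (dis S-max (In⇒∈ agree x-in) (In⇒∈ agree y-in) (In⇒∈ agree z-in) (adj⇒~ e xy) (adj⇒~ e xz)))

      ¬addable : ∀ {x} → ¬ Addable st x
      ¬addable {x} (x-out , x-cl , nb , unique) = Out⇒∉ agree x-out (maximal S-max (f∈A e x) dis′)
        where
        Iso : Fin m → Set
        Iso y = In st y × Closed y × ∀ z → Adj! y z → Out st z
        nb-x : ∀ {a} → a ∈ S → f e x ~ a → ∃ λ y → f e y ≡ a × Adj! x y × Iso y
        nb-x a∈S x~a with f-closed e x-cl (inside-A S-max a∈S) x~a
        ... | y , refl with nb y (~⇒adj e x~a)
        ...   | inj₁ y-out = contradiction a∈S (Out⇒∉ agree y-out)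
        ...   | inj₂ iso = y , refl , ~⇒adj e x~a , iso
        lonely : ∀ {v b} → v ∈ S → b ∈ S → f e x ~ v → ¬ v ~ b
        lonely v∈S b∈S x~v v~b with nb-x v∈S x~v
        ... | y , refl , _ , _ , y-cl , y-iso with f-closed e y-cl (inside-A S-max b∈S) v~b
        ...   | z , refl = Out⇒∉ agree (y-iso z (~⇒adj e v~b)) b∈S
        dis′ : Dis (S ∪ ⁅ f e x ⁆)
        dis′ v∈ a∈ b∈ v~a v~b with x∈S∪⁅y⁆⁻ v∈ | x∈S∪⁅y⁆⁻ a∈ | x∈S∪⁅y⁆⁻ b∈
        ... | inj₁ v∈S | inj₁ a∈S | inj₁ b∈S = dis S-max v∈S a∈S b∈S v~a v~b
        ... | inj₁ v∈S | inj₂ refl | inj₁ b∈S = contradiction v~b (lonely v∈S b∈S (~-sym v~a))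
        ... | inj₁ v∈S | inj₁ a∈S | inj₂ refl = contradiction v~a (lonely v∈S a∈S (~-sym v~b))
        ... | inj₁ v∈S | inj₂ refl | inj₂ refl = refl
        ... | inj₂ refl | inj₂ refl | _ = contradiction v~a ~-irrefl
        ... | inj₂ refl | inj₁ _ | inj₂ refl = contradiction v~b ~-irrefl
        ... | inj₂ refl | inj₁ a∈S | inj₁ b∈S with nb-x a∈S v~a | nb-x b∈S v~b
        ...   | y , refl , xy , y-in , _ | z , refl , xz , z-in , _ =
          cong (f e) (unique y xy y-in z xz z-in)

    module Leaf (st : Vec Status m) where

      IsOut IsSettled InRegion : V → Set
      IsOut v     = ∃ λ x → Out st x × f e x ≡ v
      IsSettled v = ∃ λ x → Settled st x × f e x ≡ v
      InRegion v  = IsOut v ⊎ IsSettled v ⊎ ∃ λ x → Settled st x × f e x ~ v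

      isSettled? : Decidable IsSettled
      isSettled? v = Fin.any? λ x → settled? st x ×-dec (f e x Fin.≟ v)

      inRegion? : Decidable InRegion
      inRegion? v = Fin.any? (λ x → out? st x ×-dec (f e x Fin.≟ v)) ⊎-dec isSettled? v ⊎-dec
        Fin.any? λ x → settled? st x ×-dec (f e x ~? v)

      D R : Subset n
      D = fromDec isSettled?
      R = fromDec inRegion?

      sep : ∀ {S} → Class st S → Max A S × Separates A D R S
      sep {S} (S-max , agree) = S-max , record
        { D⊆R = λ p → ∈-fromDec⁺ {P? = inRegion?} (inj₂ (inj₁ (∈-fromDec⁻ {P? = isSettled?} p)))
        ; D⊆S = λ p → D⊆S (∈-fromDec⁻ {P? = isSettled?} p)
        ; S∩R⊆D = λ v∈S v∈R → ∈-fromDec⁺ {P? = isSettled?} (S∩R⊆D v∈S (∈-fromDec⁻ {P? = inRegion?} v∈R))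
        ; N[D] = λ p y∈A v~y → ∈-fromDec⁺ {P? = inRegion?} (N[D] (∈-fromDec⁻ {P? = isSettled?} p) v~y)
        }
        where
        D⊆S : ∀ {v} → IsSettled v → v ∈ S
        D⊆S (x , (x-in , _) , refl) = In⇒∈ agree x-in
        N[D] : ∀ {v y} → IsSettled v → v ~ y → InRegion y
        N[D] (x , s , refl) v~y = inj₂ (inj₂ (x , s , v~y))
        S∩R⊆D : ∀ {v} → v ∈ S → InRegion v → IsSettled v
        S∩R⊆D v∈S (inj₁ (x , x-out , refl)) = contradiction v∈S (Out⇒∉ agree x-out)
        S∩R⊆D v∈S (inj₂ (inj₁ s)) = s
        -- The settled vertex x already has the partner y in S, so v equals y, and y is settled
        -- through x.
        S∩R⊆D v∈S (inj₂ (inj₂ (x , (x-in , inj₁ (y , xy , y-in)) , x~v))) =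
          y , (y-in , inj₁ (x , ~⇒adj e (~-sym (adj⇒~ e xy)) , x-in)) ,
          dis S-max (In⇒∈ agree x-in) (In⇒∈ agree y-in) v∈S (adj⇒~ e xy) x~v
        S∩R⊆D v∈S (inj₂ (inj₂ (x , (x-in , inj₂ (x-cl , iso)) , x~v)))
          with f-closed e x-cl (inside-A S-max v∈S) x~v
        ... | z , refl = contradiction v∈S (Out⇒∉ agree (iso z (~⇒adj e x~v)))

      removed-InRegion : ∀ {x} → Removed st x → InRegion (f e x)
      removed-InRegion (inj₁ x-out) = inj₁ (_ , x-out , refl)
      removed-InRegion (inj₂ (inj₁ s)) = inj₂ (inj₁ (_ , s , refl))
      removed-InRegion (inj₂ (inj₂ (y , xy , s))) = inj₂ (inj₂ (y , s , ~-sym (adj⇒~ e xy)))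

      extra : ∃ λ ys → maxOf (deficiency st) ≤ length ys × Unique ys ×
        (∀ {y} → y ∈ₗ ys → y ∈ₗ A × InRegion y × ¬ ∃ λ i → f e i ≡ y)
      extra with maxOf-attained (deficiency st)
      ... | inj₁ eq = [] , ≤-reflexive eq , [] , λ ()
      ... | inj₂ (i , eq) with if-does (settled? st i) (d₀ ∸ deg i)
      ...   | inj₁ eq₀ = [] , ≤-reflexive (trans eq eq₀) , [] , λ ()
      ...   | inj₂ (s , eq₁) = outer e i ,
        ≤-trans (≤-reflexive (trans eq eq₁)) (≤-trans (∸-monoˡ-≤ (deg i) (d₀≤ (f∈A e i))) (outer-degree e A! i)) ,
        outer-unique e A! i ,
        λ p → let (y∈A , i~y) , new = ∈-outer⁻ e p in y∈A , inj₂ (inj₂ (i , s , i~y)) , new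

      removed : List (Fin m)
      removed = trues (does ∘ removed? st)

      xs : List V
      xs = map (f e) removed ++ proj₁ extra

      xs-unique : Unique xs
      xs-unique = ++-unique (map-f-unique e (trues-unique (does ∘ removed? st))) (proj₁ (proj₂ (proj₂ extra)))
        λ p q → let i , _ , eq = ∈-map⁻ (f e) p in
          proj₂ (proj₂ (proj₂ (proj₂ (proj₂ extra)) q)) (i , sym eq)

      xs⊆ : ∀ {x} → x ∈ₗ xs → x ∈ₗ A × x ∈ R
      xs⊆ p with ∈-++⁻ (map (f e) removed) p
      ... | inj₁ q = let i , r , eq = ∈-map⁻ (f e) q in
        subst (λ z → z ∈ₗ A × z ∈ R) (sym eq)
          (f∈A e i , ∈-fromDec⁺ {P? = inRegion?} (removed-InRegion (does-T (removed? st i) (∈-trues⁻ {p = does ∘ removed? st} r))))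
      ... | inj₂ q = let y∈A , y∈R , _ = proj₂ (proj₂ (proj₂ extra)) q in y∈A , ∈-fromDec⁺ {P? = inRegion?} y∈R

      #removed≤ : #removed st ≤ length xs
      #removed≤ = subst (#removed st ≤_)
        (sym (trans (List.length-++ (map (f e) removed)) (cong (_+ length (proj₁ extra)) (List.length-map (f e) removed))))
        (+-monoʳ-≤ (count (does ∘ removed? st)) (proj₁ (proj₂ extra)))

      leaf-sound : W (#removed st) < Q → Weighted (Class st) (W (#removed st))
      leaf-sound w<Q = record
        { bound = F (length A ∸ r)
        ; bounds = cover-≤ (F-mono (∸-monoʳ-≤ (length A) #removed≤))
            (below-cover A! ih xs xs-unique (≤-trans (r>0 r w<Q) #removed≤) xs⊆ sep)
        ; bound≤ = subst (λ N → F (length A ∸ r) * Q ≤ F N * W r) (m+[n∸m]≡n r≤N)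
            (<⇒≤ (F-W r (length A ∸ r)))
        }
        where
        r = #removed st
        -- `W 0` exceeds `Q`, so a weight below `Q` certifies that at least one vertex is removed,
        -- as the induction hypothesis demands.
        r>0 : ∀ r → W r < Q → 0 < r
        r>0 zero w<Q = contradiction (<⇒<ᵇ w<Q) λ ()
        r>0 (suc _) _ = s≤s z≤n
        r≤N : r ≤ length A
        r≤N = ≤-trans #removed≤ (unique-⊆⇒length≤ xs-unique (proj₁ ∘ xs⊆))

    agrees-update : ∀ {st S} x s → Agrees st S →
      (T (isChosen s) → f e x ∈ S) → (T (isRejected s) → f e x ∉ S) → Agrees (st [ x ]≔ s) S
    agrees-update {st} {S} x s agree c r = record
      { In⇒∈ = λ {i} → upd isChosen {i} {_∈ S} (In⇒∈ agree) c (i Fin.≟ x)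
      ; Out⇒∉ = λ {i} → upd isRejected {i} {_∉ S} (Out⇒∉ agree) r (i Fin.≟ x)
      }
      where
      upd : ∀ (is : Status → Bool) {i} {B : V → Set} → (T (is (lookup st i)) → B (f e i)) →
        (T (is s) → B (f e x)) → Dec (i ≡ x) → T (is (lookup (st [ x ]≔ s) i)) → B (f e i)
      upd is old new (yes refl) = new ∘ subst (T ∘ is) (Vec.lookup∘update x st s)
      upd is old new (no i≢x) = old ∘ subst (T ∘ is) (Vec.lookup∘update′ i≢x st s)

    weighted-split : ∀ {st a b} x → Weighted (Class (st [ x ]≔ chosen)) a →
      Weighted (Class (st [ x ]≔ rejected)) b → Weighted (Class st) (a + b)
    weighted-split {st} {a} {b} x p q = record
      { bound = bound p + bound q
      ; bounds = cover-⊎ split (bounds p) (bounds q)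
      ; bound≤ = subst₂ _≤_ (sym (*-distribʳ-+ Q (bound p) (bound q))) (sym (*-distribˡ-+ (F (length A)) a b))
          (+-mono-≤ (bound≤ p) (bound≤ q))
      }
      where
      split : ∀ {S} → Class st S → Class (st [ x ]≔ chosen) S ⊎ Class (st [ x ]≔ rejected) S
      split {S} (S-max , agree) with f e x ∈? S
      ... | yes p = inj₁ (S-max , agrees-update x chosen agree (λ _ → p) λ ())
      ... | no ¬p = inj₂ (S-max , agrees-update x rejected agree (λ ()) λ _ → ¬p)

    -- The assumption that the weight is below `Q` descends to both branches, each being at most
    -- their sum; it is used at the leaves, where some vertex must be removed.
    weight-sound : ∀ k st → weight k st < Q → Weighted (Class st) (weight k st)
    weight-sound k st w<Q with does (infeasible? st) in eq
    weight-sound k st w<Q | true = record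
      { bound = 0 ; bounds = cover-⊥ impossible ; bound≤ = z≤n }
      where
      impossible : ∀ {S} → ¬ Class st S
      impossible (S-max , agree) with does-true (infeasible? st) eq
      ... | inj₁ c = ¬clash S-max agree c
      ... | inj₂ (x , ad) = ¬addable S-max agree ad
    weight-sound zero st w<Q | false = Leaf.leaf-sound st w<Q
    weight-sound (suc k) st w<Q | false with pick st
    ... | nothing = Leaf.leaf-sound st w<Q
    ... | just x = go (W (#removed st)) (weight k (st [ x ]≔ chosen)) (weight k (st [ x ]≔ rejected)) w<Q
        (Leaf.leaf-sound st) (weight-sound k (st [ x ]≔ chosen)) (weight-sound k (st [ x ]≔ rejected))
      where
      go : ∀ l a b → smaller l a b < Q → (l < Q → Weighted (Class st) l) →
        (a < Q → Weighted (Class (st [ x ]≔ chosen)) a) →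
        (b < Q → Weighted (Class (st [ x ]≔ rejected)) b) → Weighted (Class st) (smaller l a b)
      go l a b w<Q leaf left right with l ≤ᵇ a | l ≤ᵇ a + b
      ... | true  | _ = leaf w<Q
      ... | false | true = leaf w<Q
      ... | false | false = weighted-split x (left (≤-<-trans (m≤m+n a b) w<Q)) (right (≤-<-trans (m≤n+m b a) w<Q))

T-∨ : ∀ {a b} → T (a ∨ b) → T a ⊎ T b
T-∨ {true}  _ = inj₁ _
T-∨ {false} p = inj₂ p

allRows-sound : ∀ {m} {a : Fin m → Bool} {k} → T (allRows a k) →
  ∀ r → (∀ i → T (lookup r i) → T (a i)) → T (k r)
allRows-sound p [] h = p
allRows-sound {suc m} p (false ∷ r) h = allRows-sound (proj₁ (T-split p)) r (h ∘ suc)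
allRows-sound {suc m} {a} {k} p (true ∷ r) h with a zero | h zero _ | proj₂ (T-split {allRows (a ∘ suc) (k ∘ (false ∷_))} p)
... | true | _ | q = allRows-sound q r (h ∘ suc)

module Explore {n : ℕ} (G : Graph n) (A : List (Fin n)) where
  open Dissociation G
  open Neighbours G A

  Strict : Set
  Strict = ∃ λ b → Cover (Max A) b × b < F (length A)

  strict : ∀ {w} → w < Q → Weighted (Max A) w → Strict
  strict {w} w<Q p = bound p , bounds p , *-cancelʳ-< Q (bound p) (F (length A))
    (≤-<-trans (bound≤ p) (*-monoʳ-< (F (length A)) {{>-nonZero (F-pos (length A))}} w<Q))

  module _ (A! : Unique A) (ih : Below A) where

    weight-strict : ∀ {m} {P : Pattern m} {cl} (e : Emb P cl) {d₀} → (∀ {x} → x ∈ₗ A → d₀ ≤ degree x) →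
      ∀ k → T (Branching.weight P cl d₀ k (replicate m undecided) <ᵇ Q) → Strict
    weight-strict {m} {P} {cl} e {d₀} d₀≤ k p = strict w<Q record
      { bound = bound w ; bounds = cover-⊆ (λ mx → mx , initial) (bounds w) ; bound≤ = bound≤ w }
      where
      open WeightSound e A! ih d₀≤
      w<Q = <ᵇ⇒< (Branching.weight P cl d₀ k (replicate m undecided)) Q p
      w = weight-sound k (replicate m undecided) w<Q
      initial : ∀ {S} → Agrees (replicate m undecided) S
      initial = record
        { In⇒∈ = λ {i} q → contradiction (subst (T ∘ isChosen) (Vec.lookup-replicate i undecided) q) id
        ; Out⇒∉ = λ {i} q → contradiction (subst (T ∘ isRejected) (Vec.lookup-replicate i undecided) q) id
        }

    module _ (max-degree : ∀ {x} → x ∈ₗ A → degree x ≤ 3) where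

      explore-sound : ∀ k {m} {P : Pattern m} {cl root} (e : Emb P cl) →
        (∀ {x} → x ∈ₗ A → degree (Emb.f e root) ≤ degree x) → T (explore k P cl root) → Strict
      expand-sound : ∀ k {m} {P : Pattern m} {cl root} (e : Emb P cl) →
        (∀ {x} → x ∈ₗ A → degree (Emb.f e root) ≤ degree x) → ∀ x → T (expand k P cl root x) → Strict

      explore-sound (suc k) {m} {P} {cl} {root} e root-min p
        with T-∨ {does (Fin.any? λ x → T? (lookup cl x) ×-dec (count (adj P x) <? count (adj P root)))} p
      -- A closed vertex has its full degree inside the pattern. If that is below the pattern degree
      -- of the root, the root does not have minimum degree.
      ... | inj₁ q = let x , c , x<root = does-T (Fin.any? λ x → T? (lookup cl x) ×-dec (count (adj P x) <? count (adj P root))) q in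
        contradiction (≤-<-trans (Emb.closed-degree e A! c) x<root)
          (≤⇒≯ (≤-trans (Emb.inner-degree e A! root) (root-min (Emb.f∈A e x))))
      ... | inj₂ p with T-∨ {does (Fin.any? λ x → 3 <? count (adj P x))} p
      ...   | inj₁ q = let x , 3<x = does-T (Fin.any? λ x → 3 <? count (adj P x)) q in
        contradiction (<-≤-trans 3<x (Emb.inner-degree e A! x)) (≤⇒≯ (max-degree (Emb.f∈A e x)))
      ...   | inj₂ p with T-∨ {Branching.weight P cl (count (adj P root)) (suc m) (replicate m undecided) <ᵇ Q} p
      ...     | inj₁ q = weight-strict e
        (λ x∈A → ≤-trans (Emb.inner-degree e A! root) (root-min x∈A)) (suc m) q
      ...     | inj₂ q = expand-sound k e root-min
        (lastMax λ x → if lookup cl x then 0 else suc (count (adj P x))) q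

      expand-sound k {m} {P} {cl} {root} e root-min (just x) p with T-split {explore k P (cl [ x ]≔ true) root} p
      ... | p₁ , p₂ with Any.any? (λ y → (Emb.f e x ~? y) ×-dec ¬? (Emb.image? e y)) A
      ...   | no ∄y = explore-sound k (close e x inner) root-min p₁
        where
        inner : ∀ {y} → y ∈ₗ A → Emb.f e x ~ y → ∃ λ j → Emb.f e j ≡ y
        inner {y} y∈A x~y = decidable-stable (Emb.image? e y) λ new →
          ∄y (Any.map (λ { refl → x~y , new }) y∈A)
      ...   | yes ∃y = go (find ∃y)
        where
        go : ∃ (λ y → y ∈ₗ A × Emb.f e x ~ y × ¬ ∃ λ i → Emb.f e i ≡ y) → Strict
        go (y , y∈A , x~y , new) = [ (λ q → contradiction row-x (¬T-not q)) , explore-sound k (extend e y∈A new) root-min ]′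
          (T-∨ (allRows-sound p₂ row row⊆))
          where
          row = tabulate (λ i → Adj G y (Emb.f e i))
          row-x : T (lookup row x)
          row-x = subst T (sym (Vec.lookup∘tabulate _ x)) (~-sym x~y)
          not-T : ∀ b → ¬ T b → T (not b)
          not-T false _ = _
          not-T true h = contradiction _ h
          row⊆ : ∀ i → T (lookup row i) → T (not (lookup cl i))
          row⊆ i r = not-T (lookup cl i) λ c →
            let j , eq = Emb.f-closed e c y∈A (~-sym (subst T (Vec.lookup∘tabulate _ i) r)) in new (j , eq)

      explore-strict : ∀ k {m} {P : Pattern m} {cl root} (e : Emb P cl) →
        (∀ {x} → x ∈ₗ A → degree (Emb.f e root) ≤ degree x) → explore k P cl root ≡ true → Strict
      explore-strict k e root-min = explore-sound k e root-min ∘ Equivalence.from T-≡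

-- Vertices of degree at least four

module _ where
  open +-*-Solver

  -- Here and in the next four inequalities `x`, `y`, `z` stand for consecutive values of `F`; a
  -- factor 10 is a shift of the argument by five.
  arith-4-all : ∀ x y → x * 14 < y * 9 → x * 10 + (y + 4 * x) < y * 10
  arith-4-all x y h = subst₂ _<_
    (solve 2 (λ x y → x :* con 14 :+ y := x :* con 10 :+ (y :+ con 4 :* x)) refl x y)
    (solve 1 (λ y → y :* con 9 :+ y := y :* con 10) refl y)
    (+-monoˡ-< y h)

  arith-4-some : ∀ x y s → x * 11 < y * 7 → s + y ≤ 4 * y + x → x * 10 + (0 + s) < y * 10
  arith-4-some x y s h h′ = +-cancelʳ-< y (x * 10 + s) (y * 10) (begin-strict
    x * 10 + s + y          ≡⟨ +-assoc (x * 10) s y ⟩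
    x * 10 + (s + y)        ≤⟨ +-monoʳ-≤ (x * 10) h′ ⟩
    x * 10 + (4 * y + x)    ≡⟨ solve 2 (λ x y → x :* con 10 :+ (con 4 :* y :+ x) := x :* con 11 :+ y :* con 4) refl x y ⟩
    x * 11 + y * 4          <⟨ +-monoˡ-< (y * 4) h ⟩
    y * 7 + y * 4           ≡⟨ solve 1 (λ y → y :* con 7 :+ y :* con 4 := y :* con 10 :+ y) refl y ⟩
    y * 10 + y              ∎)
    where open ≤-Reasoning

  arith-7 : ∀ x y z → x * 3 < y * 2 → y * 3 < z * 2 → y * 10 + x * 7 < z * 10
  arith-7 x y z h h′ = *-cancelʳ-< 3 (y * 10 + x * 7) (z * 10) (begin-strict
    (y * 10 + x * 7) * 3   ≡⟨ solve 2 (λ x y → (y :* con 10 :+ x :* con 7) :* con 3 := y :* con 30 :+ x :* con 3 :* con 7) refl x y ⟩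
    y * 30 + x * 3 * 7     ≤⟨ +-monoʳ-≤ (y * 30) (*-monoˡ-≤ 7 (<⇒≤ h)) ⟩
    y * 30 + y * 2 * 7     ≡⟨ solve 1 (λ y → y :* con 30 :+ y :* con 2 :* con 7 := y :* con 44) refl y ⟩
    y * 44                 ≤⟨ *-monoʳ-≤ y (n≤1+n 44) ⟩
    y * 45                 ≡⟨ *-assoc y 3 15 ⟨
    y * 3 * 15             <⟨ *-monoˡ-< 15 h′ ⟩
    z * 2 * 15             ≡⟨ solve 1 (λ z → z :* con 2 :* con 15 := z :* con 10 :* con 3) refl z ⟩
    z * 10 * 3             ∎)
    where open ≤-Reasoning

  arith-5-all : ∀ x y z → x * 3 < y * 2 → y * 3 < z * 2 → y * 10 + (y + 5 * x) < z * 10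
  arith-5-all x y z h h′ = *-cancelʳ-< 3 (y * 10 + (y + 5 * x)) (z * 10) (begin-strict
    (y * 10 + (y + 5 * x)) * 3  ≡⟨ solve 2 (λ x y → (y :* con 10 :+ (y :+ con 5 :* x)) :* con 3 := y :* con 33 :+ x :* con 3 :* con 5) refl x y ⟩
    y * 33 + x * 3 * 5     ≤⟨ +-monoʳ-≤ (y * 33) (*-monoˡ-≤ 5 (<⇒≤ h)) ⟩
    y * 33 + y * 2 * 5     ≡⟨ solve 1 (λ y → y :* con 33 :+ y :* con 2 :* con 5 := y :* con 43) refl y ⟩
    y * 43                 ≤⟨ *-monoʳ-≤ y (m≤m+n 43 2) ⟩
    y * 45                 ≡⟨ *-assoc y 3 15 ⟨
    y * 3 * 15             <⟨ *-monoˡ-< 15 h′ ⟩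
    z * 2 * 15             ≡⟨ solve 1 (λ z → z :* con 2 :* con 15 := z :* con 10 :* con 3) refl z ⟩
    z * 10 * 3             ∎)
    where open ≤-Reasoning

  arith-5-some : ∀ x y s → x * 3 < y * 2 → s ≤ 5 * x → x * 10 + (0 + s) < y * 10
  arith-5-some x y s h h′ = begin-strict
    x * 10 + s        ≤⟨ +-monoʳ-≤ (x * 10) h′ ⟩
    x * 10 + 5 * x    ≡⟨ solve 1 (λ x → x :* con 10 :+ con 5 :* x := x :* con 3 :* con 5) refl x ⟩
    x * 3 * 5         <⟨ *-monoˡ-< 5 h ⟩
    y * 2 * 5         ≡⟨ *-assoc y 2 5 ⟩
    y * 10            ∎
    where open ≤-Reasoning

  arith-linear : ∀ x y z s → y * 3 < z * 2 → x ≤ y → s ≤ y * 7 → x + s ≤ z * 7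
  arith-linear x y z s h x≤y h′ = begin
    x + s         ≤⟨ +-mono-≤ x≤y h′ ⟩
    y + y * 7     ≡⟨ solve 1 (λ y → y :+ y :* con 7 := y :* con 8) refl y ⟩
    y * 8         ≤⟨ *-monoʳ-≤ y (n≤1+n 8) ⟩
    y * 9         ≡⟨ *-assoc y 3 3 ⟨
    y * 3 * 3     ≤⟨ *-monoˡ-≤ 3 (<⇒≤ h) ⟩
    z * 2 * 3     ≡⟨ *-assoc z 2 3 ⟩
    z * 6         ≤⟨ *-monoʳ-≤ z (n≤1+n 6) ⟩
    z * 7         ∎
    where open ≤-Reasoning

-- Raising the degree by one adds a single `F m` on the left, while the right side grows by a factor
-- above 3/2, more than the 8/7 that is needed. This reduces all degrees above six to degree six.
F-linear : ∀ j m → (7 + j) * F m ≤ F (j + m) * 7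
F-linear zero    m = ≤-reflexive (*-comm 7 (F m))
F-linear (suc j) m = arith-linear (F m) (F (j + m)) (F (suc (j + m))) ((7 + j) * F m)
  (F-3/2 (j + m)) (F-mono (m≤n+m m j)) (F-linear j m)

sum-const : ∀ {I : Set} c (is : List I) → sum (map (λ _ → c) is) ≡ length is * c
sum-const c []       = refl
sum-const c (_ ∷ is) = cong (c +_) (sum-const c is)

module _ {I : Set} {P : I → Set} (P? : Decidable P) (p q : ℕ) where

  weigh : I → ℕ
  weigh i = if does (P? i) then q else p

  sum-all : ∀ {is} → All P is → sum (map weigh is) ≡ length is * q
  sum-all [] = refl
  sum-all {i ∷ _} (Pi ∷ Pis) with P? i
  ... | yes _ = cong (q +_) (sum-all Pis)
  ... | no ¬Pi = contradiction Pi ¬Pi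

  module _ (q≤p : q ≤ p) where

    weigh≤ : ∀ i → weigh i ≤ p
    weigh≤ i with P? i
    ... | yes _ = q≤p
    ... | no _  = ≤-refl

    sum≤ : ∀ is → sum (map weigh is) ≤ length is * p
    sum≤ [] = z≤n
    sum≤ (i ∷ is) = +-mono-≤ (weigh≤ i) (sum≤ is)

    -- At least one summand is q instead of p. The difference is moved to the other side because
    -- subtraction on naturals truncates.
    sum-any : ∀ {is} → Any P is → sum (map weigh is) + p ≤ length is * p + q
    sum-any {i ∷ is} (here Pi) with P? i
    ... | no ¬Pi = contradiction Pi ¬Pi
    ... | yes _ = begin
      q + sum (map weigh is) + p    ≡⟨ solve 3 (λ q s p → q :+ s :+ p := p :+ s :+ q) refl q (sum (map weigh is)) p ⟩
      p + sum (map weigh is) + q    ≤⟨ +-monoˡ-≤ q (+-monoʳ-≤ p (sum≤ is)) ⟩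
      p + length is * p + q         ∎
      where
      open ≤-Reasoning
      open +-*-Solver
    sum-any {i ∷ is} (there Pis) = begin
      weigh i + sum (map weigh is) + p     ≡⟨ +-assoc (weigh i) _ p ⟩
      weigh i + (sum (map weigh is) + p)   ≤⟨ +-mono-≤ (weigh≤ i) (sum-any Pis) ⟩
      p + (length is * p + q)              ≡⟨ +-assoc p (length is * p) q ⟨
      p + length is * p + q                ∎
      where open ≤-Reasoning

module HighDegree {n : ℕ} (G : Graph n) (A : List (Fin n)) (A! : Unique A)
  (ih : Dissociation.Below G A) {v : Fin n} (v∈A : v ∈ₗ A) where
  open Dissociation G
  open Neighbours G A
  open Explore G A

  us : List V
  us = nbrs v

  d size : ℕ
  d = degree v
  size = length A

  Leaves : V → Set
  Leaves u = Any (λ w → u ~ w × w ≢ v × ¬ v ~ w) A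

  leaves? : Decidable Leaves
  leaves? u = Any.any? (λ w → (u ~? w) ×-dec ¬? (w Fin.≟ v) ×-dec ¬? (v ~? w)) A

  ¬leaves : ∀ {u} → ¬ Leaves u → ∀ {w} → w ∈ₗ A → u ~ w → w ≡ v ⊎ v ~ w
  ¬leaves h {w} w∈A u~w with w Fin.≟ v | v ~? w
  ... | yes eq | _ = inj₁ eq
  ... | no _ | yes v~w = inj₂ v~w
  ... | no w≢v | no v≁w = contradiction (Any.map (λ { refl → u~w , w≢v , v≁w }) w∈A) h

  N[v] : List V
  N[v] = v ∷ us

  N[v]-unique : Unique N[v]
  N[v]-unique = All.tabulate (λ u∈ eq → ~-irrefl (subst (v ~_) (sym eq) (proj₂ (∈-nbrs⁻ u∈)))) ∷ nbrs-unique A! v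

  N[v]⊆A : ∀ {x} → x ∈ₗ N[v] → x ∈ₗ A
  N[v]⊆A (here refl) = v∈A
  N[v]⊆A (there p) = proj₁ (∈-nbrs⁻ p)

  Deleted Alone : Subset n → Set
  Deleted S = Max A S × v ∉ S
  Alone S   = Max A S × v ∈ S × ∀ {u} → u ∈ₗ us → u ∉ S

  Paired : V → Subset n → Set
  Paired u S = Max A S × v ∈ S × u ∈ S

  deleted-cover : Cover Deleted (F (size ∸ 1))
  deleted-cover = below-cover {D = Data.Fin.Subset.⊥} {R = ⁅ v ⁆} A! ih (v ∷ []) ([] ∷ []) (s≤s z≤n)
    (λ { (here refl) → v∈A , x∈⁅x⁆ v })
    λ (S-max , v∉S) → S-max , record
      { D⊆R = λ p → contradiction p ∉⊥
      ; D⊆S = λ p → contradiction p ∉⊥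
      ; S∩R⊆D = λ p q → contradiction (subst (_∈ _) (x∈⁅y⁆⇒x≡y v q) p) v∉S
      ; N[D] = λ p → contradiction p ∉⊥
      }

  alone-cover : Cover Alone (F (size ∸ suc d))
  alone-cover = below-cover {D = ⁅ v ⁆} {R = fromDec R?} A! ih N[v] N[v]-unique (s≤s z≤n)
    (λ p → N[v]⊆A p , ∈-fromDec⁺ {P? = R?} (mem p))
    λ {S} (S-max , v∈S , alone) → S-max , record
      { D⊆R = λ p → ∈-fromDec⁺ {P? = R?} (inj₁ (x∈⁅y⁆⇒x≡y v p))
      ; D⊆S = λ p → subst (_∈ S) (sym (x∈⁅y⁆⇒x≡y v p)) v∈S
      ; S∩R⊆D = λ {x} p q → [ (λ { refl → x∈⁅x⁆ v }) ,
          (λ v~x → contradiction p (alone (∈-nbrs⁺ (inside-A S-max p) v~x))) ]′ (∈-fromDec⁻ {P? = R?} q)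
      ; N[D] = λ {x} {y} p y∈A x~y → ∈-fromDec⁺ {P? = R?} (inj₂ (subst (_~ y) (x∈⁅y⁆⇒x≡y v p) x~y))
      }
    where
    R? : Decidable λ y → y ≡ v ⊎ v ~ y
    R? y = (y Fin.≟ v) ⊎-dec (v ~? y)
    mem : ∀ {x} → x ∈ₗ N[v] → x ≡ v ⊎ v ~ x
    mem (here eq) = inj₁ eq
    mem (there p) = inj₂ (proj₂ (∈-nbrs⁻ p))

  module _ {u} (u∈us : u ∈ₗ us) where

    v~u : v ~ u
    v~u = proj₂ (∈-nbrs⁻ u∈us)

    private
      R? : Decidable λ y → y ≡ v ⊎ v ~ y ⊎ u ~ y
      R? y = (y Fin.≟ v) ⊎-dec ((v ~? y) ⊎-dec (u ~? y))

      D = ⁅ v ⁆ ∪ ⁅ u ⁆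

      D⁻ : ∀ {x} → x ∈ D → x ≡ v ⊎ x ≡ u
      D⁻ p = [ inj₁ ∘ x∈⁅y⁆⇒x≡y v , inj₂ ∘ x∈⁅y⁆⇒x≡y u ]′ (x∈p∪q⁻ ⁅ v ⁆ ⁅ u ⁆ p)

      sep : ∀ {S} → Paired u S → Max A S × Separates A D (fromDec R?) S
      sep {S} (S-max , v∈S , u∈S) = S-max , record
        { D⊆R = λ p → ∈-fromDec⁺ {P? = R?} ([ inj₁ , (λ { refl → inj₂ (inj₁ v~u) }) ]′ (D⁻ p))
        ; D⊆S = λ p → [ (λ { refl → v∈S }) , (λ { refl → u∈S }) ]′ (D⁻ p)
        ; S∩R⊆D = λ {x} x∈S x∈R → S∩R⊆D x∈S (∈-fromDec⁻ {P? = R?} x∈R)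
        ; N[D] = λ {x} {y} p _ x~y → ∈-fromDec⁺ {P? = R?}
            ([ (λ { refl → inj₂ (inj₁ x~y) }) , (λ { refl → inj₂ (inj₂ x~y) }) ]′ (D⁻ p))
        }
        where
        S∩R⊆D : ∀ {x} → x ∈ S → x ≡ v ⊎ v ~ x ⊎ u ~ x → x ∈ D
        S∩R⊆D x∈S (inj₁ refl) = x∈p∪q⁺ (inj₁ (x∈⁅x⁆ v))
        S∩R⊆D x∈S (inj₂ (inj₁ v~x)) with dis S-max v∈S u∈S x∈S v~u v~x
        ... | refl = x∈p∪q⁺ (inj₂ (x∈⁅x⁆ u))
        S∩R⊆D x∈S (inj₂ (inj₂ u~x)) with dis S-max u∈S v∈S x∈S (~-sym v~u) u~x
        ... | refl = x∈p∪q⁺ (inj₁ (x∈⁅x⁆ v))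

      mem : ∀ {x} → x ∈ₗ N[v] → x ∈ fromDec R?
      mem (here eq) = ∈-fromDec⁺ {P? = R?} (inj₁ eq)
      mem (there p) = ∈-fromDec⁺ {P? = R?} (inj₂ (inj₁ (proj₂ (∈-nbrs⁻ p))))

    paired-cover : Cover (Paired u) (F (size ∸ suc d))
    paired-cover = below-cover A! ih N[v] N[v]-unique (s≤s z≤n) (λ p → N[v]⊆A p , mem p) sep

    module _ (out : Leaves u) where
      private
        w : V
        w = proj₁ (find out)
        w∈A : w ∈ₗ A
        w∈A = proj₁ (proj₂ (find out))
        w-out : u ~ w × w ≢ v × ¬ v ~ w
        w-out = proj₂ (proj₂ (find out))

        xs! : Unique (w ∷ N[v])
        xs! = (proj₁ (proj₂ w-out) ∷ All.tabulate λ p eq →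
          proj₂ (proj₂ w-out) (subst (v ~_) (sym eq) (proj₂ (∈-nbrs⁻ p)))) ∷ N[v]-unique

        xs⊆ : ∀ {x} → x ∈ₗ w ∷ N[v] → x ∈ₗ A × x ∈ fromDec R?
        xs⊆ (here refl) = w∈A , ∈-fromDec⁺ {P? = R?} (inj₂ (inj₂ (proj₁ w-out)))
        xs⊆ (there p) = N[v]⊆A p , mem p

      paired-cover′ : Cover (Paired u) (F (size ∸ suc (suc d)))
      paired-cover′ = below-cover A! ih (w ∷ N[v]) xs! (s≤s z≤n) xs⊆ sep

      leaves⇒2+d≤N : suc (suc d) ≤ size
      leaves⇒2+d≤N = unique-⊆⇒length≤ xs! (proj₁ ∘ xs⊆)

    -- A neighbour u of v with N[u] ⊆ N[v] could be added to a set in which v is alone.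
    ¬alone : ¬ Leaves u → ∀ {S} → ¬ Alone S
    ¬alone ¬out {S} (S-max , v∈S , alone) = alone u∈us (maximal S-max (proj₁ (∈-nbrs⁻ u∈us)) dis′)
      where
      only-v : ∀ {x} → x ∈ S → u ~ x → x ≡ v
      only-v x∈S u~x with ¬leaves ¬out (inside-A S-max x∈S) u~x
      ... | inj₁ eq = eq
      ... | inj₂ v~x = contradiction x∈S (alone (∈-nbrs⁺ (inside-A S-max x∈S) v~x))
      lonely : ∀ {x y} → x ∈ S → y ∈ S → u ~ x → ¬ x ~ y
      lonely x∈S y∈S u~x x~y with only-v x∈S u~x
      ... | refl = alone (∈-nbrs⁺ (inside-A S-max y∈S) x~y) y∈S
      dis′ : Dis (S ∪ ⁅ u ⁆)
      dis′ x∈ a∈ b∈ x~a x~b with x∈S∪⁅y⁆⁻ x∈ | x∈S∪⁅y⁆⁻ a∈ | x∈S∪⁅y⁆⁻ b∈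
      ... | inj₁ x∈S | inj₁ a∈S | inj₁ b∈S = dis S-max x∈S a∈S b∈S x~a x~b
      ... | inj₁ x∈S | inj₂ refl | inj₁ b∈S = contradiction x~b (lonely x∈S b∈S (~-sym x~a))
      ... | inj₁ x∈S | inj₁ a∈S | inj₂ refl = contradiction x~a (lonely x∈S a∈S (~-sym x~b))
      ... | inj₁ _ | inj₂ refl | inj₂ refl = refl
      ... | inj₂ refl | inj₂ refl | _ = contradiction x~a ~-irrefl
      ... | inj₂ refl | inj₁ _ | inj₂ refl = contradiction x~b ~-irrefl
      ... | inj₂ refl | inj₁ a∈S | inj₁ b∈S = trans (only-v a∈S x~a) (sym (only-v b∈S x~b))

  classify : ∀ {S} → Max A S → Deleted S ⊎ Alone S ⊎ ∃ λ u → u ∈ₗ us × Paired u S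
  classify {S} S-max with v ∈? S
  ... | no v∉S = inj₁ (S-max , v∉S)
  ... | yes v∈S with Any.any? (_∈? S) us
  ...   | yes p = let u , u∈us , u∈S = find p in inj₂ (inj₂ (u , u∈us , S-max , v∈S , u∈S))
  ...   | no ∄u = inj₂ (inj₁ (S-max , v∈S , λ u∈us u∈S → ∄u (Any.map (λ { refl → u∈S }) u∈us)))

  total : ∀ {a} (b : V → ℕ) → Cover Alone a → (∀ {u} → u ∈ₗ us → Cover (Paired u) (b u)) →
    Cover (Max A) (F (size ∸ 1) + (a + sum (map b us)))
  total b alone paired = cover-⊎ classify deleted-cover (cover-⊎ id alone (cover-Any b us paired))

  d<N : suc d ≤ size
  d<N = unique-⊆⇒length≤ N[v]-unique N[v]⊆A

  paired : ∀ {u} → u ∈ₗ us → Cover (Paired u) (weigh leaves? (F (size ∸ suc d)) (F (size ∸ suc (suc d))) u)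
  paired {u} u∈us with leaves? u
  ... | yes out = paired-cover′ u∈us out
  ... | no _    = paired-cover u∈us

  private
    q≤p : F (size ∸ suc (suc d)) ≤ F (size ∸ suc d)
    q≤p = F-mono (∸-monoʳ-≤ size (n≤1+n (suc d)))

    rest : ∀ k → k ≤ size → ∃ λ m → size ≡ k + m
    rest k k≤N = size ∸ k , sym (m+[n∸m]≡n k≤N)

  -- From degree six on, removing just N[v] in each of the d + 1 cases containing v is cheap enough,
  -- wherever the edges at the neighbours lead.
  degree≥6 : 6 ≤ d → Strict
  degree≥6 6≤d with rest (suc d) d<N
  ... | m , N≡ = _ , total (λ _ → F (size ∸ suc d)) alone-cover paired-cover , (begin-strict
      F (size ∸ 1) + (F (size ∸ suc d) + sum (map (λ _ → F (size ∸ suc d)) us))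
        ≡⟨ cong₂ (λ a b → F a + (F b + sum (map (λ _ → F b) us))) (cong (_∸ 1) N≡) (trans (cong (_∸ suc d) N≡) (m+n∸m≡n (suc d) m)) ⟩
      F (d + m) + (F m + sum (map (λ _ → F m) us))
        ≡⟨ cong (λ s → F (d + m) + (F m + s)) (sum-const (F m) us) ⟩
      F (d + m) + suc d * F m
        ≡⟨ cong (λ d → F (d + m) + suc d * F m) (m+[n∸m]≡n 6≤d) ⟨
      F (6 + j + m) + (7 + j) * F m
        ≤⟨ +-monoʳ-≤ (F (6 + j + m)) (F-linear j m) ⟩
      F (suc (j + m)) * 10 + F (j + m) * 7
        <⟨ arith-7 (F (j + m)) (F (suc (j + m))) (F (suc (suc (j + m)))) (F-3/2 (j + m)) (F-3/2 (suc (j + m))) ⟩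
      F (7 + j + m)
        ≡⟨ cong (λ d → F (suc d + m)) (m+[n∸m]≡n 6≤d) ⟩
      F (suc d + m)
        ≡⟨ cong F N≡ ⟨
      F size ∎)
    where
    open ≤-Reasoning
    j = d ∸ 6

  private
    nonempty : ∀ {k} (xs : List V) → length xs ≡ suc k → ∃ λ x → x ∈ₗ xs
    nonempty (x ∷ _) _ = x , here refl

    -- Degree and size are generalised to variables: matching on the equation and the inequality
    -- writes the size as a numeral plus m, and the values of `F` then reduce to those of the
    -- arithmetic lemmas.
    small-5 : ∀ d size → d ≡ 5 → suc (suc d) ≤ size →
      F (size ∸ 1) + (F (size ∸ suc d) + d * F (size ∸ suc (suc d))) < F size
    small-5 _ _ refl (s≤s (s≤s (s≤s (s≤s (s≤s (s≤s (s≤s (z≤n {m})))))))) =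
      arith-5-all (F m) (F (suc m)) (F (suc (suc m))) (F-3/2 m) (F-3/2 (suc m))

    small-5′ : ∀ d size s → d ≡ 5 → suc d ≤ size → s ≤ d * F (size ∸ suc d) → F (size ∸ 1) + (0 + s) < F size
    small-5′ _ _ s refl (s≤s (s≤s (s≤s (s≤s (s≤s (s≤s (z≤n {m}))))))) = arith-5-some (F m) (F (suc m)) s (F-3/2 m)

    small-4 : ∀ d size → d ≡ 4 → suc (suc d) ≤ size →
      F (size ∸ 1) + (F (size ∸ suc d) + d * F (size ∸ suc (suc d))) < F size
    small-4 _ _ refl (s≤s (s≤s (s≤s (s≤s (s≤s (s≤s (z≤n {m}))))))) = arith-4-all (F m) (F (suc m)) (F-14/9 m)

    small-4′ : ∀ d size s → d ≡ 4 → suc (suc d) ≤ size →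
      s + F (size ∸ suc d) ≤ d * F (size ∸ suc d) + F (size ∸ suc (suc d)) → F (size ∸ 1) + (0 + s) < F size
    small-4′ _ _ s refl (s≤s (s≤s (s≤s (s≤s (s≤s (s≤s (z≤n {m}))))))) = arith-4-some (F m) (F (suc m)) s (F-11/7 m)

    not-all : ¬ All Leaves us → Cover Alone 0
    not-all ¬all = let u , u∈us , ¬out = find (¬All⇒Any¬ leaves? us ¬all) in cover-⊥ (¬alone u∈us ¬out)

    all-leave : (suc (suc d) ≤ size → F (size ∸ 1) + (F (size ∸ suc d) + d * F (size ∸ suc (suc d))) < F size) →
      ∀ {k} → d ≡ suc k → All Leaves us → Strict
    all-leave small d≡ all = _ , total _ alone-cover paired ,
      subst (λ s → F (size ∸ 1) + (F (size ∸ suc d) + s) < F size) (sym (sum-all leaves? _ _ all))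
        (let u , u∈us = nonempty us d≡ in small (leaves⇒2+d≤N u∈us (All.lookup all u∈us)))

  degree≡5 : d ≡ 5 → Strict
  degree≡5 d≡5 with All.all? leaves? us
  ... | yes all = all-leave (small-5 d size d≡5) d≡5 all
  ... | no ¬all = _ , total _ (not-all ¬all) paired , small-5′ d size _ d≡5 d<N (sum≤ leaves? _ _ q≤p us)

  -- If no neighbour leaves N[v], the sum is about F (m + 4) + 4 · F m with m + 5 the size, and 6.31
  -- + 4 exceeds 10. This alternative cannot be excluded by counting and is returned. If only some
  -- leave, one cheaper term and the absence of the case `Alone` suffice.
  degree≡4 : d ≡ 4 → (∀ {u} → u ∈ₗ us → ¬ Leaves u) ⊎ Strict
  degree≡4 d≡4 with All.all? leaves? us | Any.any? leaves? us
  ... | yes all | _ = inj₂ (all-leave (small-4 d size d≡4) d≡4 all)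
  ... | no _ | no none = inj₁ λ u∈us out → none (Any.map (λ { refl → out }) u∈us)
  ... | no ¬all | yes some = inj₂ (_ , total _ (not-all ¬all) paired ,
    small-4′ d size _ d≡4 (let u , u∈us , out = find some in leaves⇒2+d≤N u∈us out) (sum-any leaves? _ _ q≤p some))

-- Components that are K₅ minus a matching

record Many {A : Set} (P : A → Set) (b : ℕ) : Set where
  constructor many
  field
    list    : List A
    unique  : Unique list
    members : ∀ {x} → x ∈ₗ list → P x
    ≤length : b ≤ length list

length-cartesianProduct : ∀ {A B : Set} (xs : List A) (ys : List B) →
  length (cartesianProduct xs ys) ≡ length xs * length ys
length-cartesianProduct [] ys = refl
length-cartesianProduct (x ∷ xs) ys = trans (List.length-++ (map (x ,_) ys))
  (cong₂ _+_ (List.length-map (x ,_) ys) (length-cartesianProduct xs ys))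

VertexDisjoint-sym : ∀ {e e′} → VertexDisjoint e e′ → VertexDisjoint e′ e
VertexDisjoint-sym (p , q , r , s) = p ∘ sym , r ∘ sym , q ∘ sym , s ∘ sym

AllPairs-lookup : ∀ {A : Set} {R : A → A → Set} → (∀ {x y} → R x y → R y x) →
  ∀ {xs} → AllPairs R xs → ∀ {x y} → x ∈ₗ xs → y ∈ₗ xs → x ≡ y ⊎ R x y
AllPairs-lookup R-sym (_ ∷ _) (here refl) (here refl) = inj₁ refl
AllPairs-lookup R-sym (Rx ∷ _) (here refl) (there q) = inj₂ (All.lookup Rx q)
AllPairs-lookup R-sym (Ry ∷ _) (there p) (here refl) = inj₂ (R-sym (All.lookup Ry p))
AllPairs-lookup R-sym (_ ∷ Rs) (there p) (there q) = AllPairs-lookup R-sym Rs p q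

module K5-Matching {H : Graph 5} (k5 : IsK5MinusMatching H) where
  open Dissociation H using (_~_; ~-sym)

  private
    M = proj₁ k5
    disjoint = proj₁ (proj₂ (proj₂ (proj₂ k5)))
    edges = proj₂ (proj₂ (proj₂ (proj₂ k5)))

  missing : ∀ {i j} → i ≢ j → ¬ i ~ j → (i , j) ∈ₗ M ⊎ (j , i) ∈ₗ M
  missing {i} {j} i≢j i≁j = decidable-stable (((i , j) ∈ₗ? M) ⊎-dec ((j , i) ∈ₗ? M))
    λ ∉M → i≁j (Equivalence.from T-≡ (Equivalence.from (edges i j) (i≢j , ∉M)))
    where open DecMembership (×-≡-dec Fin._≟_ Fin._≟_) using () renaming (_∈?_ to _∈ₗ?_)

  -- Two missing edges at i share a vertex, so they are the same entry of M. The four cases are the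
  -- orientations in which M may store them.
  matching : ∀ {i j k} → i ≢ j → i ≢ k → ¬ i ~ j → ¬ i ~ k → j ≡ k
  matching i≢j i≢k i≁j i≁k with missing i≢j i≁j | missing i≢k i≁k
  ... | inj₁ p | inj₁ q with AllPairs-lookup VertexDisjoint-sym disjoint p q
  ...   | inj₁ refl = refl
  ...   | inj₂ (d , _) = contradiction refl d
  matching i≢j i≢k i≁j i≁k | inj₁ p | inj₂ q with AllPairs-lookup VertexDisjoint-sym disjoint p q
  ...   | inj₁ refl = refl
  ...   | inj₂ (_ , d , _) = contradiction refl d
  matching i≢j i≢k i≁j i≁k | inj₂ p | inj₁ q with AllPairs-lookup VertexDisjoint-sym disjoint p q
  ...   | inj₁ refl = refl
  ...   | inj₂ (_ , _ , d , _) = contradiction refl d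
  matching i≢j i≢k i≁j i≁k | inj₂ p | inj₂ q with AllPairs-lookup VertexDisjoint-sym disjoint p q
  ...   | inj₁ refl = refl
  ...   | inj₂ (_ , _ , _ , d) = contradiction refl d

  -- Among three vertices at most one edge is missing, since two missing ones would meet. Hence no
  -- dissociation set contains three vertices of the component.
  centre : ∀ {i j k} → i ≢ j → i ≢ k → j ≢ k →
    (i ~ j × i ~ k) ⊎ (j ~ i × j ~ k) ⊎ (k ~ i × k ~ j)
  centre {i} {j} {k} i≢j i≢k j≢k with T? (Adj H i j) | T? (Adj H i k) | T? (Adj H j k)
  ... | yes ij | yes ik | _ = inj₁ (ij , ik)
  ... | yes ij | no _ | yes jk = inj₂ (inj₁ (~-sym ij , jk))
  ... | no _ | yes ik | yes jk = inj₂ (inj₂ (~-sym ik , ~-sym jk))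
  ... | no i≁j | no i≁k | _ = contradiction (matching i≢j i≢k i≁j i≁k) j≢k
  ... | no i≁j | yes _ | no j≁k = contradiction (matching (i≢j ∘ sym) j≢k (i≁j ∘ ~-sym) j≁k) i≢k
  ... | yes _ | no i≁k | no j≁k = contradiction (matching (i≢k ∘ sym) (j≢k ∘ sym) (i≁k ∘ ~-sym) (j≁k ∘ ~-sym)) i≢j

-- Two, at least three, and at most one element. In `Small` the witness i outside t can be added:
-- all elements of t equal j, so at most two vertices result.
Pair Triple Small : Subset 5 → Set
Pair t   = ∃₂ λ p q → p ≢ q × p ∈ t × q ∈ t × ∀ k → k ∈ t → k ≡ p ⊎ k ≡ q
Triple t = ∃ λ i → i ∈ t × ∃ λ j → j ∈ t × i ≢ j × ∃ λ k → k ∈ t × i ≢ k × j ≢ k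
Small t  = ∃₂ λ i j → i ∉ t × ∀ k → k ∈ t → k ≡ j

pair? : Decidable Pair
pair? t = Fin.any? λ p → Fin.any? λ q → ¬? (p Fin.≟ q) ×-dec (p ∈? t) ×-dec (q ∈? t) ×-dec
  Fin.all? λ k → (k ∈? t) →-dec ((k Fin.≟ p) ⊎-dec (k Fin.≟ q))

triple? : Decidable Triple
triple? t = Fin.any? λ i → (i ∈? t) ×-dec Fin.any? λ j → (j ∈? t) ×-dec ¬? (i Fin.≟ j) ×-dec
  Fin.any? λ k → (k ∈? t) ×-dec ¬? (i Fin.≟ k) ×-dec ¬? (j Fin.≟ k)

small? : Decidable Small
small? t = Fin.any? λ i → Fin.any? λ j → ¬? (i ∈? t) ×-dec Fin.all? λ k → (k ∈? t) →-dec (k Fin.≟ j)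

shape : ∀ t → Pair t ⊎ Triple t ⊎ Small t
shape t = All.lookup (toWitness {a? = All.all? (λ t → pair? t ⊎-dec triple? t ⊎-dec small? t) (allSubsets 5)} _)
  (allSubsets-complete t)

abstract

  pairs : List (Subset 5)
  pairs = filter pair? (allSubsets 5)

  ∈-pairs⁺ : ∀ {t} → Pair t → t ∈ₗ pairs
  ∈-pairs⁺ {t} = ∈-filter⁺ pair? (allSubsets-complete t)

  ∈-pairs⁻ : ∀ {t} → t ∈ₗ pairs → Pair t
  ∈-pairs⁻ p = proj₂ (∈-filter⁻ pair? {xs = allSubsets 5} p)

  pairs-unique : Unique pairs
  pairs-unique = Unique.filter⁺ pair? (allSubsets-unique 5)

  length-pairs : length pairs ≡ 10
  length-pairs = refl

record Component {n} (G : Graph n) (A : List (Fin n)) {m} (H : Graph m) : Set where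
  field
    f        : Fin m → Fin n
    f-inj    : ∀ {i j} → f i ≡ f j → i ≡ j
    f∈A      : ∀ i → f i ∈ₗ A
    f-adj    : ∀ i j → Adj G (f i) (f j) ≡ Adj H i j
    f-closed : ∀ i {y} → y ∈ₗ A → T (Adj G (f i) y) → ∃ λ j → f j ≡ y

  image? : Decidable λ y → ∃ λ i → f i ≡ y
  image? y = Fin.any? λ i → f i Fin.≟ y

  C : Subset n
  C = fromDec image?

module K5-Component {n} {G : Graph n} {A : List (Fin n)} {H : Graph 5} (k5 : IsK5MinusMatching H)
  (c : Component G A H) where
  open Dissociation G
  open Component c
  open K5-Matching {H} k5

  adj⇒~ : ∀ {i j} → T (Adj H i j) → f i ~ f j
  adj⇒~ {i} {j} = subst T (sym (f-adj i j))

  put? : ∀ t → Decidable λ v → ∃ λ i → i ∈ t × f i ≡ v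
  put? t v = Fin.any? λ i → (i ∈? t) ×-dec (f i Fin.≟ v)

  put : Subset 5 → Subset n
  put t = fromDec (put? t)

  trace : Subset n → Subset 5
  trace S = fromDec λ i → f i ∈? S

  triple-free : ∀ {S t} → Dis S → (∀ {i} → i ∈ t → f i ∈ S) → ¬ Triple t
  triple-free dis t⊆S (i , i∈ , j , j∈ , i≢j , k , k∈ , i≢k , j≢k) with centre i≢j i≢k j≢k
  ... | inj₁ (ij , ik) = j≢k (f-inj (dis (t⊆S i∈) (t⊆S j∈) (t⊆S k∈) (adj⇒~ ij) (adj⇒~ ik)))
  ... | inj₂ (inj₁ (ji , jk)) = i≢k (f-inj (dis (t⊆S j∈) (t⊆S i∈) (t⊆S k∈) (adj⇒~ ji) (adj⇒~ jk)))
  ... | inj₂ (inj₂ (ki , kj)) = i≢j (f-inj (dis (t⊆S k∈) (t⊆S i∈) (t⊆S j∈) (adj⇒~ ki) (adj⇒~ kj)))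

  not-small : ∀ {S} → Max A S → ¬ Small (trace S)
  not-small {S} S-max (i , j , i∉ , only-j) =
    i∉ (∈-fromDec⁺ {P? = λ i → f i ∈? S} (maximal S-max (f∈A i) dis′))
    where
    S∪ = S ∪ ⁅ f i ⁆
    S∪⊆A : ∀ {x} → x ∈ S∪ → x ∈ₗ A
    S∪⊆A p = [ inside-A S-max , (λ { refl → f∈A i }) ]′ (x∈S∪⁅y⁆⁻ p)
    two : ∀ {k} → f k ∈ S∪ → k ≡ i ⊎ k ≡ j
    two {k} p with x∈S∪⁅y⁆⁻ p
    ... | inj₁ q = inj₂ (only-j k (∈-fromDec⁺ {P? = λ i → f i ∈? S} q))
    ... | inj₂ eq = inj₁ (f-inj eq)
    dis-C : ∀ {v a b} → v ≡ i ⊎ v ≡ j → a ≡ i ⊎ a ≡ j → b ≡ i ⊎ b ≡ j → f v ~ f a → f v ~ f b → f a ≡ f b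
    dis-C (inj₁ refl) (inj₁ refl) _ v~a _ = contradiction v~a ~-irrefl
    dis-C (inj₁ refl) (inj₂ refl) (inj₁ refl) _ v~b = contradiction v~b ~-irrefl
    dis-C (inj₁ refl) (inj₂ refl) (inj₂ refl) _ _ = refl
    dis-C (inj₂ refl) (inj₂ refl) _ v~a _ = contradiction v~a ~-irrefl
    dis-C (inj₂ refl) (inj₁ refl) (inj₂ refl) _ v~b = contradiction v~b ~-irrefl
    dis-C (inj₂ refl) (inj₁ refl) (inj₁ refl) _ _ = refl
    dis′ : Dis S∪
    dis′ {v} {a} {b} v∈ a∈ b∈ v~a v~b with image? v
    ... | yes (v , refl) with f-closed v (S∪⊆A a∈) v~a | f-closed v (S∪⊆A b∈) v~b
    ...   | a , refl | b , refl = dis-C (two v∈) (two a∈) (two b∈) v~a v~b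
    dis′ {v} {a} {b} v∈ a∈ b∈ v~a v~b | no v∉C = dis S-max (old v∈ v∉C) (old a∈ (away v~a)) (old b∈ (away v~b)) v~a v~b
      where
      away : ∀ {x} → v ~ x → ¬ ∃ λ i → f i ≡ x
      away v~x (k , refl) = v∉C (f-closed k (S∪⊆A v∈) (~-sym v~x))
      old : ∀ {x} → x ∈ S∪ → (¬ ∃ λ i → f i ≡ x) → x ∈ S
      old p x∉C = [ id , (λ { refl → contradiction (i , refl) x∉C }) ]′ (x∈S∪⁅y⁆⁻ p)

  trace∈pairs : ∀ {S} → Max A S → trace S ∈ₗ pairs
  trace∈pairs {S} S-max = [ ∈-pairs⁺ , [ (λ tr → contradiction tr
      (triple-free (dis S-max) (∈-fromDec⁻ {P? = λ i → f i ∈? S}))) ,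
      (λ sm → contradiction sm (not-small S-max)) ]′ ]′ (shape (trace S))

  separates : ∀ {S} → Max A S → Separates A (put (trace S)) C S
  separates {S} S-max = record
    { D⊆R = λ p → let i , _ , eq = ∈-fromDec⁻ {P? = put? (trace S)} p in ∈-fromDec⁺ {P? = image?} (i , eq)
    ; D⊆S = λ p → let i , q , eq = ∈-fromDec⁻ {P? = put? (trace S)} p in
        subst (_∈ S) eq (∈-fromDec⁻ {P? = λ i → f i ∈? S} q)
    ; S∩R⊆D = λ {x} p q → let i , eq = ∈-fromDec⁻ {P? = image?} q in ∈-fromDec⁺ {P? = put? (trace S)}
        (i , ∈-fromDec⁺ {P? = λ i → f i ∈? S} (subst (_∈ S) (sym eq) p) , eq)
    ; N[D] = λ {x} {y} p y∈A x~y → let i , _ , eq = ∈-fromDec⁻ {P? = put? (trace S)} p in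
        ∈-fromDec⁺ {P? = image?} (f-closed i y∈A (subst (_~ y) (sym eq) x~y))
    }

  -- A maximal set is determined by its trace, one of ten pairs, and its part outside the component.
  -- The bound b is arbitrary, so strict bounds for the rest are passed on as well.
  component-cover : ∀ {b} → Cover (Max (A ∖ C)) b → Cover (Max A) (b * 10)
  component-cover {b} cov = cover-⊆ (λ S-max → _ , trace∈pairs S-max , S-max , refl)
    (cover-≤ (≤-reflexive (trans (sum-const b pairs) (trans (cong (_* b) length-pairs) (*-comm 10 b))))
      (cover-Any {P = λ t S → Max A S × trace S ≡ t} (λ _ → b) pairs
        λ {t} _ → separate-cover {A} {put t} {C} (λ { (S-max , refl) → S-max , separates S-max }) cov))

  module _ {S : Subset n} (S-max : Max (A ∖ C) S) {t : Subset 5} (t∈ : t ∈ₗ pairs) where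

    private
      S⁺ = S ∪ put t

    S∌C : ∀ {i} → f i ∉ S
    S∌C {i} p = proj₂ (∈-∖⁻ A C (inside-A S-max p)) (∈-fromDec⁺ {P? = image?} (i , refl))

    S⁺⁻ : ∀ {x} → x ∈ S⁺ → x ∈ S ⊎ ∃ λ i → i ∈ t × f i ≡ x
    S⁺⁻ p = [ inj₁ , inj₂ ∘ ∈-fromDec⁻ {P? = put? t} ]′ (x∈p∪q⁻ S (put t) p)

    put⁺ : ∀ {i} → i ∈ t → f i ∈ S⁺
    put⁺ {i} p = x∈p∪q⁺ {p = S} (inj₂ (∈-fromDec⁺ {P? = put? t} (i , p , refl)))

    S⁺⊆A : ∀ {x} → x ∈ S⁺ → x ∈ₗ A
    S⁺⊆A p with S⁺⁻ p
    ... | inj₁ q = proj₁ (∈-∖⁻ A C (inside-A S-max q))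
    ... | inj₂ (i , _ , refl) = f∈A i

    in-C : ∀ {i} → f i ∈ S⁺ → i ∈ t
    in-C p with S⁺⁻ p
    ... | inj₁ q = contradiction q S∌C
    ... | inj₂ (j , j∈t , eq) = subst (_∈ t) (f-inj eq) j∈t

    join-trace : trace S⁺ ≡ t
    join-trace = ⊆-antisym (λ p → in-C (∈-fromDec⁻ {P? = λ i → f i ∈? S⁺} p))
      λ p → ∈-fromDec⁺ {P? = λ i → f i ∈? S⁺} (put⁺ p)

    join-rest : S⁺ ─ C ≡ S
    join-rest = ⊆-antisym to λ {x} p → x∈p∧x∉q⇒x∈p─q (x∈p∪q⁺ (inj₁ p)) (proj₂ (∈-∖⁻ A C (inside-A S-max p)))
      where
      to : S⁺ ─ C ⊆ S
      to p with x∈p─q⁻ S⁺ C p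
      ... | p , x∉C with S⁺⁻ p
      ...   | inj₁ q = q
      ...   | inj₂ (i , _ , eq) = contradiction (∈-fromDec⁺ {P? = image?} (i , eq)) x∉C

    join-dis : Dis S⁺
    join-dis {v} {a} {b} v∈ a∈ b∈ v~a v~b with S⁺⁻ v∈
    ... | inj₁ v∈S = dis S-max v∈S (old a∈ v~a) (old b∈ v~b) v~a v~b
      where
      old : ∀ {x} → x ∈ S⁺ → v ~ x → x ∈ S
      old x∈ v~x with S⁺⁻ x∈
      ... | inj₁ q = q
      ... | inj₂ (i , _ , refl) with f-closed i (S⁺⊆A v∈) (~-sym v~x)
      ...   | j , refl = contradiction v∈S S∌C
    ... | inj₂ (i , i∈t , refl) with f-closed i (S⁺⊆A a∈) v~a | f-closed i (S⁺⊆A b∈) v~b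
    ...   | j , refl | k , refl =
      let p , q , _ , _ , _ , only = ∈-pairs⁻ t∈ in
      pick-other (only i i∈t) (only j (in-C a∈)) (only k (in-C b∈))
      where
      pick-other : ∀ {p q} → i ≡ p ⊎ i ≡ q → j ≡ p ⊎ j ≡ q → k ≡ p ⊎ k ≡ q → f j ≡ f k
      pick-other (inj₁ refl) (inj₁ refl) _ = contradiction v~a ~-irrefl
      pick-other (inj₁ refl) _ (inj₁ refl) = contradiction v~b ~-irrefl
      pick-other (inj₂ refl) (inj₂ refl) _ = contradiction v~a ~-irrefl
      pick-other (inj₂ refl) _ (inj₂ refl) = contradiction v~b ~-irrefl
      pick-other _ (inj₁ refl) (inj₁ refl) = refl
      pick-other _ (inj₂ refl) (inj₂ refl) = refl

    -- A vertex outside the component that could be added could already be added to S; a further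
    -- vertex of the component would be a third one.
    join-max : Max A S⁺
    join-max = record { inside-A = S⁺⊆A ; dis = join-dis ; maximal = mx }
      where
      mx : ∀ {x} → x ∈ₗ A → Dis (S⁺ ∪ ⁅ x ⁆) → x ∈ S⁺
      mx {x} x∈A dis′ with image? x
      ... | no x∉C = x∈p∪q⁺ (inj₁ (maximal S-max
        (∈-∖⁺ C x∈A (x∉C ∘ ∈-fromDec⁻ {P? = image?}))
        λ v a b → dis′ (up v) (up a) (up b)))
        where
        up : ∀ {y} → y ∈ S ∪ ⁅ x ⁆ → y ∈ S⁺ ∪ ⁅ x ⁆
        up p = [ (λ q → x∈p∪q⁺ (inj₁ (x∈p∪q⁺ (inj₁ q)))) , (λ q → x∈p∪q⁺ (inj₂ q)) ]′ (x∈p∪q⁻ S ⁅ x ⁆ p)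
      ... | yes (i , refl) with i ∈? t
      ...   | yes i∈t = put⁺ i∈t
      ...   | no i∉t = let p , q , p≢q , p∈t , q∈t , _ = ∈-pairs⁻ t∈ in contradiction
        (p , x∈p∪q⁺ (inj₁ p∈t) , q , x∈p∪q⁺ (inj₁ q∈t) , p≢q , i , x∈p∪q⁺ (inj₂ (x∈⁅x⁆ i)) ,
          (λ { refl → i∉t p∈t }) , (λ { refl → i∉t q∈t }))
        (triple-free {t = t ∪ ⁅ i ⁆} dis′ up)
        where
        up : ∀ {j} → j ∈ t ∪ ⁅ i ⁆ → f j ∈ S⁺ ∪ ⁅ f i ⁆
        up j∈ = [ (λ q → x∈p∪q⁺ (inj₁ (put⁺ q))) , (λ q → x∈p∪q⁺ (inj₂ (subst (λ k → f k ∈ ⁅ f i ⁆) (sym (x∈⁅y⁆⇒x≡y i q)) (x∈⁅x⁆ (f i))))) ]′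
          (x∈p∪q⁻ t ⁅ i ⁆ j∈)

  -- On these lists `split` undoes `join`, so distinct combinations of a pair and a set give
  -- distinct sets.
  component-many : ∀ {b} → Many (Max (A ∖ C)) b → Many (Max A) (10 * b)
  component-many {b} (many zs zs! zs-max b≤) = many (map join ts) (Unique.map⁻ (subst Unique (sym split-join) ts!)) members
    (subst (10 * b ≤_) (sym (trans (List.length-map join ts) (trans (length-cartesianProduct pairs zs) (cong (_* length zs) length-pairs)))) (*-monoʳ-≤ 10 b≤))
    where
    join : Subset 5 × Subset n → Subset n
    join (t , S) = S ∪ put t
    split : Subset n → Subset 5 × Subset n
    split S = trace S , S ─ C
    ts = cartesianProduct pairs zs
    ts! : Unique ts
    ts! = Unique.cartesianProduct⁺ pairs-unique zs!
    ts⁻ : ∀ {p} → p ∈ₗ ts → proj₁ p ∈ₗ pairs × proj₂ p ∈ₗ zs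
    ts⁻ = ∈-cartesianProduct⁻ pairs zs
    split-join : map split (map join ts) ≡ ts
    split-join = trans (sym (List.map-∘ ts)) (List.map-id-local (All.tabulate λ {(t , S)} p →
      let t∈ , S∈ = ts⁻ p in cong₂ _,_ (join-trace (zs-max S∈) t∈) (join-rest (zs-max S∈) t∈)))
    members : ∀ {S} → S ∈ₗ map join ts → Max A S
    members p with ∈-map⁻ join p
    ... | (t , S) , q , refl = let t∈ , S∈ = ts⁻ q in join-max (zs-max S∈) t∈

  component-size : Unique A → length A ≡ 5 + length (A ∖ C)
  component-size A! = ≤-antisym
    (unique-⊆⇒length≤ {ys = map f (allFin 5) ++ A ∖ C} A! λ p → mem p (image? _))
    (length-∖ {A} {C} (map f (allFin 5)) A! (Unique.map⁺ f-inj (Unique.allFin⁺ 5)) λ p →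
      let i , _ , eq = ∈-map⁻ f p in
      subst (λ x → x ∈ₗ A × x ∈ C) (sym eq) (f∈A i , ∈-fromDec⁺ {P? = image?} (i , refl)))
    where
    mem : ∀ {x} → x ∈ₗ A → Dec (∃ λ i → f i ≡ x) → x ∈ₗ map f (allFin 5) ++ A ∖ C
    mem p (yes (i , refl)) = ∈-++⁺ˡ (∈-map⁺ f (∈-allFin i))
    mem p (no x∉C) = ∈-++⁺ʳ (map f (allFin 5)) (∈-∖⁺ C p (x∉C ∘ ∈-fromDec⁻ {P? = image?}))

-- Graphs on five vertices with a universal vertex

patternGraph : ∀ {m} → Pattern m → Graph m
patternGraph P = record { Adj = adj P ; sym = adj-sym P ; loopless = adj-loopless P }
  where
  adj-sym : ∀ {m} (P : Pattern m) u v → adj P u v ≡ adj P v u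
  adj-sym (P ▸ r) zero    zero    = refl
  adj-sym (P ▸ r) zero    (suc v) = refl
  adj-sym (P ▸ r) (suc u) zero    = refl
  adj-sym (P ▸ r) (suc u) (suc v) = adj-sym P u v
  adj-loopless : ∀ {m} (P : Pattern m) v → adj P v v ≡ false
  adj-loopless (P ▸ r) zero    = refl
  adj-loopless (P ▸ r) (suc v) = adj-loopless P v

nonEdges : Graph 5 → List (Fin 5 × Fin 5)
nonEdges H = filter (λ (u , v) → (u Fin.<? v) ×-dec ¬? (T? (Adj H u v))) (cartesianProduct (allFin 5) (allFin 5))

-- The condition of `IsK5MinusMatching` for a given M. No search over M is necessary: up to order
-- and orientation, the list of non-edges is the only candidate.
MissesMatching : Graph 5 → List (Fin 5 × Fin 5) → Set
MissesMatching H M = length M ≤ 2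
  × All (λ e → proj₁ e ≢ proj₂ e) M
  × AllPairs VertexDisjoint M
  × (∀ u v → (Adj H u v ≡ true) ⇔ (u ≢ v × ¬ ((u , v) ∈ₗ M ⊎ (v , u) ∈ₗ M)))

missesMatching? : ∀ H M → Dec (MissesMatching H M)
missesMatching? H M = (length M ≤? 2)
  ×-dec All.all? (λ e → ¬? (proj₁ e Fin.≟ proj₂ e)) M
  ×-dec AllPairs.allPairs? (λ (a , b) (c , d) →
    ¬? (a Fin.≟ c) ×-dec ¬? (a Fin.≟ d) ×-dec ¬? (b Fin.≟ c) ×-dec ¬? (b Fin.≟ d)) M
  ×-dec Fin.all? λ u → Fin.all? λ v →
    ⇔-dec (Adj H u v Bool.≟ true) (¬? (u Fin.≟ v) ×-dec ¬? (((u , v) ∈ₗ? M) ⊎-dec ((v , u) ∈ₗ? M)))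
  where
  open DecMembership (×-≡-dec Fin._≟_ Fin._≟_) using () renaming (_∈?_ to _∈ₗ?_)
  ⇔-dec : ∀ {A B : Set} → Dec A → Dec B → Dec (A ⇔ B)
  ⇔-dec a? b? = map′ (λ (f , g) → mk⇔ f g) (λ e → Equivalence.to e , Equivalence.from e)
    ((a? →-dec b?) ×-dec (b? →-dec a?))

-- All five vertices are closed, so a fully decided case removes all of them and weighs `W 5`, just
-- over Q / 10. Ten such cases, as for K₅ minus a matching, exceed `Q`; nine stay below it.
fiveOk : Pattern 5 → Bool
fiveOk P = does (missesMatching? (patternGraph P) (nonEdges (patternGraph P))) ∨
  (Branching.weight P (replicate 5 true) 0 5 (replicate 5 undecided) <ᵇ Q)

-- The last entry of a row is the adjacency to the oldest vertex. Fixing it to `true` makes that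
-- vertex universal.
starRows : ∀ {m} → (Vec Bool (suc m) → Bool) → Bool
starRows k = allRows (λ _ → true) λ r → k (r ∷ʳ true)

starRows-sound : ∀ {m} {k : Vec Bool (suc m) → Bool} → T (starRows k) → ∀ r → T (lookup r (Fin.fromℕ m)) → T (k r)
starRows-sound {m} {k} p r r-last = subst (T ∘ k) (snoc r r-last) (allRows-sound p (init r) _)
  where
  snoc : ∀ {m} (r : Vec Bool (suc m)) → T (lookup r (Fin.fromℕ m)) → init r ∷ʳ true ≡ r
  snoc {zero}  (true ∷ []) _ = refl
  snoc {suc m} (x ∷ r) h = cong (x ∷_) (snoc r h)

abstract

  -- Evaluation over the 1 · 2 · 4 · 8 = 64 labelled graphs in which the oldest vertex is universal.
  five-check : (starRows λ r₁ → starRows λ r₂ → starRows λ r₃ → starRows λ r₄ →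
    fiveOk (∅ ▸ [] ▸ r₁ ▸ r₂ ▸ r₃ ▸ r₄)) ≡ true
  five-check = refl

five-sound : ∀ P → T (fiveOk P) → IsK5MinusMatching (patternGraph P) ⊎
  T (Branching.weight P (replicate 5 true) 0 5 (replicate 5 undecided) <ᵇ Q)
five-sound P p = [ (λ q → inj₁ (nonEdges (patternGraph P) ,
    does-T (missesMatching? (patternGraph P) (nonEdges (patternGraph P))) q)) , inj₂ ]′
  (T-∨ {does (missesMatching? (patternGraph P) (nonEdges (patternGraph P)))} p)

star-sound : ∀ (ok : Pattern 5 → Bool) → (starRows λ r₁ → starRows λ r₂ → starRows λ r₃ → starRows λ r₄ →
    ok (∅ ▸ [] ▸ r₁ ▸ r₂ ▸ r₃ ▸ r₄)) ≡ true →
  ∀ {r₁ r₂ r₃ r₄} → T (lookup r₁ (Fin.fromℕ 0)) → T (lookup r₂ (Fin.fromℕ 1)) →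
  T (lookup r₃ (Fin.fromℕ 2)) → T (lookup r₄ (Fin.fromℕ 3)) → T (ok (∅ ▸ [] ▸ r₁ ▸ r₂ ▸ r₃ ▸ r₄))
star-sound ok check {r₁} {r₂} {r₃} {r₄} h₁ h₂ h₃ h₄ =
  starRows-sound {k = ok₄} (starRows-sound {k = ok₃} (starRows-sound {k = ok₂} (starRows-sound {k = ok₁}
    (Equivalence.from T-≡ check) r₁ h₁) r₂ h₂) r₃ h₃) r₄ h₄
  where
  ok₄ : Vec Bool 4 → Bool
  ok₄ r = ok (∅ ▸ [] ▸ r₁ ▸ r₂ ▸ r₃ ▸ r)
  ok₃ : Vec Bool 3 → Bool
  ok₃ r = starRows λ r₄ → ok (∅ ▸ [] ▸ r₁ ▸ r₂ ▸ r ▸ r₄)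
  ok₂ : Vec Bool 2 → Bool
  ok₂ r = starRows λ r₃ → starRows λ r₄ → ok (∅ ▸ [] ▸ r₁ ▸ r ▸ r₃ ▸ r₄)
  ok₁ : Vec Bool 1 → Bool
  ok₁ r = starRows λ r₂ → starRows λ r₃ → starRows λ r₄ → ok (∅ ▸ [] ▸ r ▸ r₂ ▸ r₃ ▸ r₄)

five-dichotomy : ∀ {r₁ r₂ r₃ r₄} → T (lookup r₁ (Fin.fromℕ 0)) → T (lookup r₂ (Fin.fromℕ 1)) →
  T (lookup r₃ (Fin.fromℕ 2)) → T (lookup r₄ (Fin.fromℕ 3)) → let P = ∅ ▸ [] ▸ r₁ ▸ r₂ ▸ r₃ ▸ r₄ in
  IsK5MinusMatching (patternGraph P) ⊎
  T (Branching.weight P (replicate 5 true) 0 5 (replicate 5 undecided) <ᵇ Q)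
five-dichotomy {r₁} {r₂} {r₃} {r₄} h₁ h₂ h₃ h₄ =
  five-sound (∅ ▸ [] ▸ r₁ ▸ r₂ ▸ r₃ ▸ r₄) (star-sound fiveOk five-check {r₁} {r₂} {r₃} {r₄} h₁ h₂ h₃ h₄)

abstract

  -- The complete case analysis for maximum degree three, by evaluation. It starts from the root
  -- alone with nothing known about its neighbours; `30` is a depth at which every line of the
  -- search has ended.
  explore-check : explore 30 (∅ ▸ []) (false ∷ []) zero ≡ true
  explore-check = refl

-- Decomposition into components

module Structure {n : ℕ} (G : Graph n) where
  open Dissociation G

  K5-Part : List V → Set
  K5-Part A = ∃ λ H → IsK5MinusMatching H × Component G A H

  module _ (A : List V) where
    open Neighbours G A
    open Explore G A

    module _ {v : V} (v∈A : v ∈ₗ A) where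

      single : Emb (∅ ▸ []) (false ∷ [])
      single = record
        { f = λ _ → v
        ; f-inj = λ { {zero} {zero} _ → refl }
        ; f∈A = λ _ → v∈A
        ; f-adj = λ { zero zero → Graph.loopless G v }
        ; f-closed = λ { {zero} () }
        }

    component : ∀ {P : Pattern 5} (e : Emb P (replicate 5 true)) →
      IsK5MinusMatching (patternGraph P) → K5-Part A
    component {P} e k5 = patternGraph P , k5 , record
      { f = Emb.f e ; f-inj = Emb.f-inj e ; f∈A = Emb.f∈A e ; f-adj = Emb.f-adj e
      ; f-closed = λ i → Emb.f-closed e (subst T (sym (Vec.lookup-replicate i true)) _)
      }

    closeAll : ∀ {m} {P : Pattern m} {cl} (e : Emb P cl) →
      (∀ i {y} → y ∈ₗ A → Emb.f e i ~ y → ∃ λ j → Emb.f e j ≡ y) → Emb P (replicate m true)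
    closeAll e h = record
      { f = Emb.f e ; f-inj = Emb.f-inj e ; f∈A = Emb.f∈A e ; f-adj = Emb.f-adj e
      ; f-closed = λ {i} _ → h i
      }

    min-degree : ∀ x xs → ∃ λ v → v ∈ₗ x ∷ xs × (∀ {y} → y ∈ₗ x ∷ xs → degree v ≤ degree y)
    min-degree x [] = x , here refl , λ { (here refl) → ≤-refl }
    min-degree x (x′ ∷ xs) with min-degree x′ xs
    ... | v , v∈ , v-min with ≤-total (degree x) (degree v)
    ...   | inj₁ x≤v = x , here refl , λ { (here refl) → ≤-refl ; (there p) → ≤-trans x≤v (v-min p) }
    ...   | inj₂ v≤x = v , there v∈ , λ { (here refl) → v≤x ; (there p) → v-min p }

    module _ (A! : Unique A) (ih : Below A) where

      five : ∀ {v u₁ u₂ u₃ u₄} → Unique (v ∷ u₁ ∷ u₂ ∷ u₃ ∷ u₄ ∷ []) →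
        v ∈ₗ A → u₁ ∈ₗ A → u₂ ∈ₗ A → u₃ ∈ₗ A → u₄ ∈ₗ A →
        v ~ u₁ → v ~ u₂ → v ~ u₃ → v ~ u₄ →
        (∀ {x y} → x ∈ₗ v ∷ u₁ ∷ u₂ ∷ u₃ ∷ u₄ ∷ [] → y ∈ₗ A → x ~ y → y ∈ₗ v ∷ u₁ ∷ u₂ ∷ u₃ ∷ u₄ ∷ []) →
        Strict ⊎ K5-Part A
      five {v} {u₁} {u₂} {u₃} {u₄}
        ((v≢₁ ∷ v≢₂ ∷ v≢₃ ∷ v≢₄ ∷ []) ∷ (₁≢₂ ∷ ₁≢₃ ∷ ₁≢₄ ∷ []) ∷ (₂≢₃ ∷ ₂≢₄ ∷ []) ∷ (₃≢₄ ∷ []) ∷ [] ∷ [])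
        v∈ u₁∈ u₂∈ u₃∈ u₄∈ v~₁ v~₂ v~₃ v~₄ closed =
        [ inj₂ ∘ component e , inj₁ ∘ weight-strict A! ih e (λ _ → z≤n) 5 ]′
        (five-dichotomy (~-sym v~₁) (~-sym v~₂) (~-sym v~₃) (~-sym v~₄))
        where
        e₁ = extend (single v∈) u₁∈ λ { (zero , eq) → v≢₁ eq }
        e₂ = extend e₁ u₂∈ λ { (zero , eq) → ₁≢₂ eq ; (suc zero , eq) → v≢₂ eq }
        e₃ = extend e₂ u₃∈ λ { (zero , eq) → ₂≢₃ eq ; (suc zero , eq) → ₁≢₃ eq ; (suc (suc zero) , eq) → v≢₃ eq }
        e₄ = extend e₃ u₄∈ λ { (zero , eq) → ₃≢₄ eq ; (suc zero , eq) → ₂≢₄ eq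
          ; (suc (suc zero) , eq) → ₁≢₄ eq ; (suc (suc (suc zero)) , eq) → v≢₄ eq }
        -- New vertices enter at index `zero`, so the indices run against the order of the list.
        index : ∀ {y} → y ∈ₗ v ∷ u₁ ∷ u₂ ∷ u₃ ∷ u₄ ∷ [] → ∃ λ j → Emb.f e₄ j ≡ y
        index (here refl) = suc (suc (suc (suc zero))) , refl
        index (there (here refl)) = suc (suc (suc zero)) , refl
        index (there (there (here refl))) = suc (suc zero) , refl
        index (there (there (there (here refl)))) = suc zero , refl
        index (there (there (there (there (here refl))))) = zero , refl
        listed : ∀ i → Emb.f e₄ i ∈ₗ v ∷ u₁ ∷ u₂ ∷ u₃ ∷ u₄ ∷ []
        listed zero = there (there (there (there (here refl))))
        listed (suc zero) = there (there (there (here refl)))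
        listed (suc (suc zero)) = there (there (here refl))
        listed (suc (suc (suc zero))) = there (here refl)
        listed (suc (suc (suc (suc zero)))) = here refl
        e = closeAll e₄ λ i y∈A i~y → index (closed (listed i) y∈A i~y)

      degree≡4 : ∀ {v} → v ∈ₗ A → degree v ≡ 4 → Strict ⊎ K5-Part A
      degree≡4 {v} v∈A d≡4 with HighDegree.degree≡4 G A A! ih v∈A d≡4
      ... | inj₂ st = inj₁ st
      ... | inj₁ none = go (nbrs v) refl d≡4
        where
        open HighDegree G A A! ih v∈A using (N[v]-unique; N[v]⊆A; ¬leaves)
        go : ∀ us → us ≡ nbrs v → length us ≡ 4 → Strict ⊎ K5-Part A
        go (u₁ ∷ u₂ ∷ u₃ ∷ u₄ ∷ []) eq _ = five (subst (λ us → Unique (v ∷ us)) (sym eq) N[v]-unique)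
          v∈A (A∋ (here refl)) (A∋ (there (here refl))) (A∋ (there (there (here refl)))) (A∋ (there (there (there (here refl)))))
          (v~ (here refl)) (v~ (there (here refl))) (v~ (there (there (here refl)))) (v~ (there (there (there (here refl)))))
          closed
          where
          us : List V
          us = u₁ ∷ u₂ ∷ u₃ ∷ u₄ ∷ []
          to : ∀ {x} → x ∈ₗ us → x ∈ₗ nbrs v
          to {x} = subst (x ∈ₗ_) eq
          A∋ : ∀ {x} → x ∈ₗ us → x ∈ₗ A
          A∋ p = proj₁ (∈-nbrs⁻ (to p))
          v~ : ∀ {x} → x ∈ₗ us → v ~ x
          v~ p = proj₂ (∈-nbrs⁻ (to p))
          nb : ∀ {y} → y ∈ₗ A → v ~ y → y ∈ₗ us
          nb {y} y∈A v~y = subst (y ∈ₗ_) (sym eq) (∈-nbrs⁺ y∈A v~y)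
          closed : ∀ {x y} → x ∈ₗ v ∷ us → y ∈ₗ A → x ~ y → y ∈ₗ v ∷ us
          closed (here refl) y∈A x~y = there (nb y∈A x~y)
          closed (there p) y∈A x~y = [ here , there ∘ nb y∈A ]′ (¬leaves (none (to p)) y∈A x~y)

      degree≥4 : ∀ {v} → v ∈ₗ A → 4 ≤ degree v → Strict ⊎ K5-Part A
      degree≥4 {v} v∈A 4≤d with m≤n⇒m<n∨m≡n 4≤d
      ... | inj₂ 4≡d = degree≡4 v∈A (sym 4≡d)
      ... | inj₁ 5≤d with m≤n⇒m<n∨m≡n 5≤d
      ...   | inj₂ 5≡d = inj₁ (HighDegree.degree≡5 G A A! ih v∈A (sym 5≡d))
      ...   | inj₁ 6≤d = inj₁ (HighDegree.degree≥6 G A A! ih v∈A 6≤d)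

      nonempty : ∀ {v} → v ∈ₗ A → (∀ {y} → y ∈ₗ A → degree v ≤ degree y) → Strict ⊎ K5-Part A
      nonempty {v} v∈A v-min with Any.any? (λ x → 4 ≤? degree x) A
      ... | yes p = let x , x∈A , 4≤d = find p in degree≥4 x∈A 4≤d
      ... | no ∄x = inj₁ (explore-strict A! ih
        (λ x∈A → ≤-pred (≰⇒> λ 4≤d → ∄x (Any.map (λ { refl → 4≤d }) x∈A)))
        30 {root = zero} (single v∈A) v-min explore-check)

  data Decomposition : List V → Set where
    empty : Decomposition []
    step  : ∀ {A H} → IsK5MinusMatching H → (c : Component G A H) →
      Decomposition (A ∖ Component.C c) → Decomposition A

  decomposition-cover : ∀ {A} → Unique A → Decomposition A → Cover (Max A) (F (length A))
  decomposition-cover A! empty = cover (Data.Fin.Subset.⊥ ∷ [])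
    (λ S-max → here (⊆-antisym (λ p → contradiction (inside-A S-max p) λ ()) (λ p → contradiction p ∉⊥)))
    (≤ᵇ⇒≤ (1 * K) (F 0) _)
  decomposition-cover {A} A! (step k5 c d) =
    subst (λ k → Cover (Max A) (F k)) (sym (component-size A!))
      (component-cover (decomposition-cover (∖-unique (Component.C c) A!) d))
    where open K5-Component k5 c

  decomposition-many : ∀ {A} → Unique A → Decomposition A →
    ∃ λ k → length A ≡ k * 5 × Many (Max A) (10 ^ k)
  decomposition-many A! empty = 0 , refl , many (Data.Fin.Subset.⊥ ∷ []) ([] ∷ [])
    (λ { (here refl) → record
      { inside-A = λ p → contradiction p ∉⊥ ; dis = λ p → contradiction p ∉⊥ ; maximal = λ () } }) ≤-refl
  decomposition-many A! (step k5 c d) with decomposition-many (∖-unique (Component.C c) A!) d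
  ... | k , eq , mn = suc k , trans (component-size A!) (cong (5 +_) eq) , component-many mn
    where open K5-Component k5 c

  -- Induction on the number of vertices. Either alternative for a smaller list yields the bound by
  -- `F`, which is the hypothesis `Below`. If a component K₅ minus a matching splits off, strictness
  -- of the rest survives multiplication by 10.
  dichotomy : ∀ A → Unique A → Explore.Strict G A ⊎ Decomposition A
  dichotomy A A! = go (suc (length A)) A A! ≤-refl
    where
    open Explore G
    go : ∀ k A → Unique A → length A < k → Strict A ⊎ Decomposition A
    go (suc k) [] A! _ = inj₂ empty
    go (suc k) A@(x ∷ xs) A! (s≤s A≤k) =
      let v , v∈A , v-min = min-degree A x xs in
      [ inj₁ , (λ (H , k5 , c) → split k5 c) ]′ (nonempty A A! below v∈A v-min)
      where
      below : Below A
      below B B! B<A = [ (λ (b , cov , b<F) → cover-≤ (<⇒≤ b<F) cov) , decomposition-cover B! ]′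
        (go k B B! (<-≤-trans B<A A≤k))
      split : ∀ {H} → IsK5MinusMatching H → (c : Component G A H) → Strict A ⊎ Decomposition A
      split k5 c = [ (λ (b , cov , b<F) → inj₁ (b * 10 , component-cover cov ,
          subst (λ l → b * 10 < F l) (sym (component-size A!)) (*-monoˡ-< 10 b<F)))
        , inj₂ ∘ step k5 c ]′
        (go k (A ∖ Component.C c) (∖-unique (Component.C c) A!)
          (≤-trans (s≤s (m≤n+m _ 4)) (≤-trans (≤-reflexive (sym (component-size A!))) A≤k)))
        where open K5-Component k5 c

-- Agreement with the definitions in the statement

∣p∣≤1⇒unique : ∀ {n} {p : Subset n} → ∣ p ∣ ≤ 1 → ∀ {a b} → a ∈ p → b ∈ p → a ≡ b
∣p∣≤1⇒unique {p = p} ∣p∣≤1 {a} {b} a∈p b∈p with a Fin.≟ b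
... | yes a≡b = a≡b
... | no a≢b = contradiction
  (≤-trans (s≤s (≤-<-trans z≤n (x∈p⇒∣p-x∣<∣p∣ (x∈p∧x≢y⇒x∈p-y b∈p (a≢b ∘ sym))))) (x∈p⇒∣p-x∣<∣p∣ a∈p))
  (≤⇒≯ ∣p∣≤1)

unique⇒∣p∣≤1 : ∀ {n} {p : Subset n} → (∀ {a b} → a ∈ p → b ∈ p → a ≡ b) → ∣ p ∣ ≤ 1
unique⇒∣p∣≤1 {p = []} _ = z≤n
unique⇒∣p∣≤1 {p = outside ∷ p} h = unique⇒∣p∣≤1 λ a b → Fin.suc-injective (h (Data.Vec.there a) (Data.Vec.there b))
unique⇒∣p∣≤1 {suc n} {inside ∷ p} h = s≤s (≤-reflexive (trans (cong ∣_∣ (Empty-unique empty)) (∣⊥∣≡0 n)))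
  where
  empty : ¬ ∃ λ x → x ∈ p
  empty (x , x∈p) = Fin.0≢1+n (h Data.Vec.here (Data.Vec.there x∈p))

module _ {n : ℕ} (G : Graph n) where
  open Dissociation G

  ∈-N⁺ : ∀ {v x} → v ~ x → x ∈ N G v
  ∈-N⁺ {v} {x} p = Vec.lookup⇒[]= x _ (trans (Vec.lookup∘tabulate _ x) (Equivalence.to T-≡ p))

  ∈-N⁻ : ∀ {v x} → x ∈ N G v → v ~ x
  ∈-N⁻ {v} {x} p = Equivalence.from T-≡ (trans (sym (Vec.lookup∘tabulate _ x)) (Vec.[]=⇒lookup p))

  Dis⇒IsDissociation : ∀ {S} → Dis S → IsDissociation G S
  Dis⇒IsDissociation {S} dis v v∈S = unique⇒∣p∣≤1 λ a b →
    let a∈N , a∈S = x∈p∩q⁻ (N G v) S a ; b∈N , b∈S = x∈p∩q⁻ (N G v) S b in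
    dis v∈S a∈S b∈S (∈-N⁻ a∈N) (∈-N⁻ b∈N)

  IsDissociation⇒Dis : ∀ {S} → IsDissociation G S → Dis S
  IsDissociation⇒Dis isDis v∈S a∈S b∈S v~a v~b =
    ∣p∣≤1⇒unique (isDis _ v∈S) (x∈p∩q⁺ (∈-N⁺ v~a , a∈S)) (x∈p∩q⁺ (∈-N⁺ v~b , b∈S))

  Max⇒IsMaximal : ∀ {S} → Max (allFin n) S → IsMaximalDissociation G S
  Max⇒IsMaximal {S} S-max = Dis⇒IsDissociation (dis S-max) , bigger
    where
    bigger : ¬ ∃ λ S′ → IsDissociation G S′ × S ⊂ S′
    bigger (S′ , dis′ , S⊆S′ , x , x∈S′ , x∉S) = x∉S (maximal S-max (∈-allFin x)
      λ v a b → IsDissociation⇒Dis dis′ (up v) (up a) (up b))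
      where
      up : ∀ {y} → y ∈ S ∪ ⁅ x ⁆ → y ∈ S′
      up p = [ S⊆S′ , (λ { refl → x∈S′ }) ]′ (x∈S∪⁅y⁆⁻ p)

  IsMaximal⇒Max : ∀ {S} → IsMaximalDissociation G S → Max (allFin n) S
  IsMaximal⇒Max {S} (isDis , bigger) = record
    { inside-A = λ _ → ∈-allFin _
    ; dis = IsDissociation⇒Dis isDis
    ; maximal = λ {x} _ dis′ → decidable-stable (x ∈? S) λ x∉S → bigger
        (S ∪ ⁅ x ⁆ , Dis⇒IsDissociation dis′ , p⊆p∪q ⁅ x ⁆ , x , x∈p∪q⁺ (inj₂ (x∈⁅x⁆ x)) , x∉S)
    }

  φ-cover : ∀ {b} → Cover (Max (allFin n)) b → φ G * K ≤ b
  φ-cover (cover xs cov len) = ≤-trans (*-monoˡ-≤ K (unique-⊆⇒length≤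
    (Unique.filter⁺ (isMaximalDissociation? G) (allSubsets-unique n))
    λ p → cov (IsMaximal⇒Max (proj₂ (∈-filter⁻ (isMaximalDissociation? G) {xs = allSubsets n} p))))) len

  φ-many : ∀ {b} → Many (Max (allFin n)) b → b ≤ φ G
  φ-many (many xs xs! xs-max b≤) = ≤-trans b≤ (unique-⊆⇒length≤ xs! λ {S} p →
    ∈-filter⁺ (isMaximalDissociation? G) (allSubsets-complete S) (Max⇒IsMaximal (xs-max p)))

  open Structure G

  -- Decompositions as disjoint unions

  -- The isomorphism is taken from the union to the graph, with vertices addressed by copy and
  -- position. In this form a copy can be split off or added without arithmetic on `Fin (k * 5)`.
  record Union (A : List V) {k : ℕ} (Hs : Fin k → Graph 5) : Set where
    field
      e     : Fin k → Fin 5 → V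
      e-inj : ∀ {a i b j} → e a i ≡ e b j → a ≡ b × i ≡ j
      e∈A   : ∀ a i → e a i ∈ₗ A
      onto  : ∀ {x} → x ∈ₗ A → ∃₂ λ a i → e a i ≡ x
      e-adj : ∀ a i b j → Adj G (e a i) (e b j) ≡ does (a Fin.≟ b) ∧ Adj (Hs a) i j

  ¬T⇒≡false : ∀ {b} → ¬ T b → b ≡ false
  ¬T⇒≡false {false} _ = refl
  ¬T⇒≡false {true} h = contradiction _ h

  decomposition⇒union : ∀ {A} → Decomposition A →
    ∃ λ k → ∃ λ (Hs : Fin k → Graph 5) → (∀ a → IsK5MinusMatching (Hs a)) × Union A Hs
  decomposition⇒union empty = 0 , (λ ()) , (λ ()) , record
    { e = λ () ; e-inj = λ { {()} } ; e∈A = λ () ; onto = λ () ; e-adj = λ () }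
  decomposition⇒union (step {A} {H} k5 c d) with decomposition⇒union d
  ... | k , Hs , k5s , u = suc k , Hs⁺ , (λ { zero → k5 ; (suc a) → k5s a }) , record
    { e = e⁺
    ; e-inj = λ {a} {i} {b} {j} → inj {a} {i} {b} {j}
    ; e∈A = λ { zero i → f∈A i ; (suc a) i → proj₁ (∈-∖⁻ A C (e∈A a i)) }
    ; onto = λ {x} x∈A → onto⁺ x∈A (image? x)
    ; e-adj = ad
    }
    where
    open Component c
    open Union u
    Hs⁺ : Fin (suc k) → Graph 5
    Hs⁺ zero    = H
    Hs⁺ (suc a) = Hs a
    e⁺ : Fin (suc k) → Fin 5 → V
    e⁺ zero    = f
    e⁺ (suc a) = e a
    apart : ∀ {i a j} → f i ≢ e a j
    apart {i} {a} {j} eq = proj₂ (∈-∖⁻ A C (e∈A a j)) (∈-fromDec⁺ {P? = image?} (i , eq))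
    separate : ∀ {i a j} → ¬ f i ~ e a j
    separate {i} {a} {j} p = apart (proj₂ (f-closed i (proj₁ (∈-∖⁻ A C (e∈A a j))) p))
    inj : ∀ {a i b j} → e⁺ a i ≡ e⁺ b j → a ≡ b × i ≡ j
    inj {zero}  {b = zero}  eq = refl , f-inj eq
    inj {zero}  {b = suc b} eq = contradiction eq apart
    inj {suc a} {b = zero}  eq = contradiction (sym eq) apart
    inj {suc a} {b = suc b} eq = let a≡b , i≡j = e-inj eq in cong suc a≡b , i≡j
    onto⁺ : ∀ {x} → x ∈ₗ A → Dec (∃ λ i → f i ≡ x) → ∃₂ λ a i → e⁺ a i ≡ x
    onto⁺ x∈A (yes (i , eq)) = zero , i , eq
    onto⁺ x∈A (no x∉C) = let a , i , eq = onto (∈-∖⁺ C x∈A (x∉C ∘ ∈-fromDec⁻ {P? = image?})) in suc a , i , eq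
    ad : ∀ a i b j → Adj G (e⁺ a i) (e⁺ b j) ≡ does (a Fin.≟ b) ∧ Adj (Hs⁺ a) i j
    ad zero    i zero    j = f-adj i j
    ad zero    i (suc b) j = ¬T⇒≡false separate
    ad (suc a) i zero    j = ¬T⇒≡false (separate ∘ ~-sym)
    ad (suc a) i (suc b) j = e-adj a i b j

  union⇒decomposition : ∀ {A k} {Hs : Fin k → Graph 5} → (∀ a → IsK5MinusMatching (Hs a)) →
    Union A Hs → Decomposition A
  union⇒decomposition {[]}    {zero} _ _ = empty
  union⇒decomposition {x ∷ _} {zero} _ u with Union.onto u (here refl)
  ... | () , _
  union⇒decomposition {A} {suc k} {Hs} k5s u = step (k5s zero) c
    (union⇒decomposition {k = k} {Hs ∘ suc} (k5s ∘ suc) record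
      { e = e ∘ suc
      ; e-inj = λ eq → let a≡b , i≡j = e-inj eq in Fin.suc-injective a≡b , i≡j
      ; e∈A = λ a i → ∈-∖⁺ (Component.C c) (e∈A (suc a) i) λ p →
          let _ , eq = ∈-fromDec⁻ {P? = Component.image? c} p in Fin.0≢1+n (proj₁ (e-inj eq))
      ; onto = λ x∈ → let x∈A , x∉C = ∈-∖⁻ A (Component.C c) x∈ in rest x∉C (onto x∈A)
      ; e-adj = λ a i b j → e-adj (suc a) i (suc b) j
      })
    where
    open Union u
    c : Component G A (Hs zero)
    c = record
      { f = e zero
      ; f-inj = proj₂ ∘ e-inj
      ; f∈A = e∈A zero
      ; f-adj = λ i j → e-adj zero i zero j
      ; f-closed = λ i y∈A i~y → closed i i~y (onto y∈A)
      }
      where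
      closed : ∀ i {y} → e zero i ~ y → (∃₂ λ a j → e a j ≡ y) → ∃ λ j → e zero j ≡ y
      closed i _ (zero , j , eq) = j , eq
      closed i i~y (suc a , j , refl) = contradiction (subst T (e-adj zero i (suc a) j) i~y) λ ()
    rest : ∀ {x} → x ∉ Component.C c → (∃₂ λ a i → e a i ≡ x) → ∃₂ λ a i → e (suc a) i ≡ x
    rest x∉C (zero , i , eq) = contradiction (∈-fromDec⁺ {P? = Component.image? c} (i , eq)) x∉C
    rest x∉C (suc a , i , eq) = a , i , eq

  unionAdj-combine : ∀ {k} (Hs : Fin k → Graph 5) a i b j →
    unionAdj Hs (Fin.combine a i) (Fin.combine b j) ≡ does (a Fin.≟ b) ∧ Adj (Hs a) i j
  unionAdj-combine {k} Hs a i b j =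
    cong₂ entry (Fin.remQuot-combine {k} {5} a i) (Fin.remQuot-combine {k} {5} b j)
    where
    -- `entry` is the body of `unionAdj` as a function of the two decoded addresses, so that
    -- rewriting both of them is a congruence.
    entry : Fin k × Fin 5 → Fin k × Fin 5 → Bool
    entry (a , i) (b , j) = does (a Fin.≟ b) ∧ Adj (Hs a) i j

  union⇒iso : ∀ {k} {Hs : Fin k → Graph 5} → Union (allFin n) Hs → IsoToUnion G Hs
  union⇒iso {k} {Hs} u = f , (f-inj , f-surj) , f-adj
    where
    open Union u
    block : V → Fin k
    block x = proj₁ (onto (∈-allFin x))
    place : V → Fin 5
    place x = proj₁ (proj₂ (onto (∈-allFin x)))
    e-at : ∀ x → e (block x) (place x) ≡ x
    e-at x = proj₂ (proj₂ (onto (∈-allFin x)))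
    f : V → Fin (k * 5)
    f x = Fin.combine (block x) (place x)
    f-inj : ∀ {x y} → f x ≡ f y → x ≡ y
    f-inj {x} {y} eq = let a≡b , i≡j = Fin.combine-injective (block x) (place x) (block y) (place y) eq in
      trans (sym (e-at x)) (trans (cong₂ e a≡b i≡j) (e-at y))
    f-e : ∀ a i → f (e a i) ≡ Fin.combine a i
    f-e a i = let a≡ , i≡ = e-inj (e-at (e a i)) in cong₂ Fin.combine a≡ i≡
    f-surj : ∀ y → ∃ λ x → ∀ {z} → z ≡ x → f z ≡ y
    f-surj y = let a , i = Fin.remQuot {k} 5 y in
      e a i , λ { refl → trans (f-e a i) (Fin.combine-remQuot {k} 5 y) }
    f-adj : ∀ x y → Adj G x y ≡ unionAdj Hs (f x) (f y)
    f-adj x y = trans (sym (cong₂ (Adj G) (e-at x) (e-at y)))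
      (trans (e-adj _ _ _ _) (sym (unionAdj-combine Hs _ _ _ _)))

  iso⇒union : ∀ {k} {Hs : Fin k → Graph 5} → IsoToUnion G Hs → Union (allFin n) Hs
  iso⇒union {k} {Hs} (f , (f-inj , f-surj) , f-adj) = record
    { e = e
    ; e-inj = λ {a} {i} {b} {j} eq →
        Fin.combine-injective a i b j (trans (sym (f-e a i)) (trans (cong f eq) (f-e b j)))
    ; e∈A = λ a i → ∈-allFin (e a i)
    ; onto = λ {x} _ → let a , i = Fin.remQuot {k} 5 (f x) in
        a , i , f-inj (trans (f-e a i) (Fin.combine-remQuot {k} 5 (f x)))
    ; e-adj = λ a i b j → trans (f-adj (e a i) (e b j))
        (trans (cong₂ (unionAdj Hs) (f-e a i) (f-e b j)) (unionAdj-combine Hs a i b j))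
    }
    where
    e : Fin k → Fin 5 → V
    e a i = proj₁ (f-surj (Fin.combine a i))
    f-e : ∀ a i → f (e a i) ≡ Fin.combine a i
    f-e a i = proj₂ (f-surj (Fin.combine a i)) refl

  -- The bound for fifth powers

  allFin! : Unique (allFin n)
  allFin! = Unique.allFin⁺ n

  length-allFin : length (allFin n) ≡ n
  length-allFin = List.length-tabulate {n = n} id

  F-bound : ∀ b → b * K ≤ F n → b ^ 5 ≤ 10 ^ n
  F-bound b h = *-cancelʳ-≤ (b ^ 5) (10 ^ n) (K ^ 5)
    (subst (_≤ 10 ^ n * K ^ 5) (^-distribˡ-* 5 b K) (≤-trans (^-monoˡ-≤ 5 h) (F-power n)))

  -- Rounding `F` down is harmless here: anything strictly below `F n` is strictly below K ·
  -- 10^(n/5).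
  F-bound-strict : ∀ b → b * K < F n → b ^ 5 < 10 ^ n
  F-bound-strict b h = *-cancelʳ-< (K ^ 5) (b ^ 5) (10 ^ n)
    (subst (_< 10 ^ n * K ^ 5) (^-distribˡ-* 5 b K) (<-≤-trans (^-monoˡ-< 5 h) (F-power n)))

  strict⇒φ^5< : Explore.Strict G (allFin n) → φ G ^ 5 < 10 ^ n
  strict⇒φ^5< (b , cov , b<F) =
    F-bound-strict (φ G) (≤-<-trans (φ-cover cov) (subst (λ l → b < F l) length-allFin b<F))

  decomposition⇒φ^5≤ : Decomposition (allFin n) → φ G ^ 5 ≤ 10 ^ n
  decomposition⇒φ^5≤ d = F-bound (φ G)
    (≤-trans (φ-cover (decomposition-cover allFin! d)) (≤-reflexive (cong F length-allFin)))

  φ^5≤ : φ G ^ 5 ≤ 10 ^ n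
  φ^5≤ = [ <⇒≤ ∘ strict⇒φ^5< , decomposition⇒φ^5≤ ]′ (dichotomy (allFin n) allFin!)

  decomposition⇒φ^5≥ : Decomposition (allFin n) → 10 ^ n ≤ φ G ^ 5
  decomposition⇒φ^5≥ d with decomposition-many allFin! d
  ... | k , eq , mn = subst (_≤ φ G ^ 5)
    (trans (^-*-assoc 10 k 5) (cong (10 ^_) (trans (sym eq) length-allFin)))
    (^-monoˡ-≤ 5 (φ-many mn))

theorem1p1 : ∀ {n : ℕ} (G : Graph n) →
    (φ G ^ 5 ≤ 10 ^ n)
    × ((φ G ^ 5 ≡ 10 ^ n) ⇔
    ((5 ∣ n) × (∃[ k ] Σ (Fin k → Graph 5) (λ Hs →
    (∀ a → IsK5MinusMatching (Hs a)) × IsoToUnion G Hs))))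
theorem1p1 {n} G = φ^5≤ G , mk⇔ to from
  where
  open Structure G
  to : φ G ^ 5 ≡ 10 ^ n → 5 ∣ n × ∃[ k ] Σ (Fin k → Graph 5) (λ Hs →
    (∀ a → IsK5MinusMatching (Hs a)) × IsoToUnion G Hs)
  to eq with dichotomy (allFin n) (allFin! G)
  ... | inj₁ st = ⊥-elim (<-irrefl eq (strict⇒φ^5< G st))
  ... | inj₂ d =
    let k , size , _ = decomposition-many (allFin! G) d ; m , Hs , k5s , u = decomposition⇒union G d in
    divides k (trans (sym (length-allFin G)) size) , m , Hs , k5s , union⇒iso G u
  from : 5 ∣ n × ∃[ k ] Σ (Fin k → Graph 5) (λ Hs →
    (∀ a → IsK5MinusMatching (Hs a)) × IsoToUnion G Hs) → φ G ^ 5 ≡ 10 ^ n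
  from (_ , k , Hs , k5s , iso) = ≤-antisym (φ^5≤ G)
    (decomposition⇒φ^5≥ G (union⇒decomposition G {Hs = Hs} k5s (iso⇒union G iso)))
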